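{- Let $f_1,\dots,f_k$ be functions $f_i:\{0,1\}^n\times\{0,1\}^n\to\{0,1\}$, each evaluated on parts of Alice's and Bob's inputs. Then (1) $GH(\bigvee_i f_i)=O(\sum_i GH(f_i))$; (2) $GH(\bigwedge_i f_i)=O(\sum_i GH(f_i))$; (3) $GH(\bigoplus_i f_i)=O(\sum_i GH(f_i))$; (4) $GH(MAJ(f_1,\dots,f_k))=O(\sum_i GH(f_i)\cdot\log^3 k)$, where $MAJ(z_1,\dots,z_k)=1$ iff $\sum_i z_i\ge k/2$.
   Context: Garden-hose model: Alice holds $x$, Bob holds $y$. A garden-hose protocol of size $s$ consists of a set $V$ of $s$ vertices (pipes) and an extra vertex $t$ (the tap), together with an assignment of a matching $E_A(x)$ on $V\cup\{t\}$ to every input $x$ of Alice and a matching $E_B(y)$ on $V$ to every input $y$ of Bob. In the graph $(V\cup\{t\},E_A(x)\cup E_B(y))$ every vertex has degree at most 2, so there is a unique maximal path starting at $t$; the output on $(x,y)$ is the parity of the number of edges of this path. The protocol computes a function if the output equals the function value for all inputs. $GH(h)$ is the minimum size of a garden-hose protocol computing $h$. Compositions such as $\bigvee_i f_i$ denote the function mapping the inputs to $\bigvee_i f_i(\cdot)$. -}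

module Defs where

open import Data.Nat using (ℕ; zero; suc; _+_; _*_; _≤_)
open import Data.Bool using (Bool; true; false; not; _∨_; _∧_; _xor_)
open import Data.Fin using (Fin; zero; suc)
open import Data.Vec using (Vec)
open import Data.Maybe using (Maybe; just; nothing)
open import Data.Product using (Σ; ∃; ∃-syntax; _×_; _,_)
open import Relation.Binary.PropositionalEquality using (_≡_; _≢_)

record Matching (m : ℕ) : Set where
  field
    partner : Fin m → Maybe (Fin m)
    symm    : ∀ u v → partner u ≡ just v → partner v ≡ just u
    irrefl  : ∀ u → partner u ≢ just u

open Matching public

-- Vertex set V ∪ {t} of a protocol of size s is Fin (suc s):
-- zero is the tap t, suc v is the pipe v ∈ V = Fin s.
-- Alice's matching lives on Fin (suc s), Bob's on Fin s (= V).

-- Following the unique maximal path from t.  Every vertex has at most one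
-- Alice-edge and at most one Bob-edge and t has no Bob-edge, so the path
-- starting at t alternates Alice-edge, Bob-edge, Alice-edge, ...
-- The boolean accumulates the parity of the number of edges traversed.
-- The fuel bounds the number of edges; the path is simple, so it has at most
-- s edges and fuel (suc s) is never exhausted.
mutual
  walkA : {s : ℕ} → Matching (suc s) → Matching s → ℕ → Fin (suc s) → Bool → Bool
  walkA A B zero    u b = b
  walkA A B (suc f) u b with partner A u
  ... | nothing = b
  ... | just w  = walkB A B f w (not b)

  walkB : {s : ℕ} → Matching (suc s) → Matching s → ℕ → Fin (suc s) → Bool → Bool
  walkB A B zero    u       b = b
  walkB A B (suc f) zero    b = b
  walkB A B (suc f) (suc v) b with partner B v
  ... | nothing = b
  ... | just w  = walkA A B f (suc w) (not b)

output : {s : ℕ} → Matching (suc s) → Matching s → Bool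
output {s} A B = walkA A B (suc s) zero false

Fn : ℕ → Set
Fn n = Vec Bool n → Vec Bool n → Bool

record Protocol (n s : ℕ) : Set where
  field
    alice : Vec Bool n → Matching (suc s)
    bob   : Vec Bool n → Matching s

open Protocol public

Computes : {n s : ℕ} → Protocol n s → Fn n → Set
Computes P h = ∀ x y → output (alice P x) (bob P y) ≡ h x y

-- "There is a garden-hose protocol of size s computing h", i.e. GH(h) ≤ s
-- (a protocol can always be padded with unused pipes).
HasGH : {n : ℕ} → Fn n → ℕ → Set
HasGH {n} h s = Σ (Protocol n s) λ P → Computes P h

GH≤ : {n : ℕ} → Fn n → ℕ → Set
GH≤ h b = ∃[ s ] (s ≤ b × HasGH h s)

sumFin : (k : ℕ) → (Fin k → ℕ) → ℕ
sumFin zero    g = 0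
sumFin (suc k) g = g zero + sumFin k (λ i → g (suc i))

foldFin : (Bool → Bool → Bool) → Bool → (k : ℕ) → (Fin k → Bool) → Bool
foldFin op e zero    z = e
foldFin op e (suc k) z = op (z zero) (foldFin op e k (λ i → z (suc i)))

countTrue : (k : ℕ) → (Fin k → Bool) → ℕ
countTrue k z = sumFin k (λ i → if-then (z i))
  where
  if-then : Bool → ℕ
  if-then true  = 1
  if-then false = 0

maj : (k : ℕ) → (Fin k → Bool) → Bool
maj k z = Data.Nat._≤ᵇ_ k (2 * countTrue k z)
  where import Data.Nat

ORf ANDf XORf MAJf : {n : ℕ} (k : ℕ) → (Fin k → Fn n) → Fn n
ORf  k f x y = foldFin _∨_ false k (λ i → f i x y)
ANDf k f x y = foldFin _∧_ true  k (λ i → f i x y)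
XORf k f x y = foldFin _xor_ false k (λ i → f i x y)
MAJf k f x y = maj k (λ i → f i x y)

{-# OPTIONS --safe #-}

-- A protocol is run three times over: once forwards, and then backwards in one
-- of two copies, depending on where the path got stuck.  This gives a gate that
-- reads f i and leaves through one of two exits, at a cost of 3 (s i + 1) pipes;
-- running a piece of the network backwards also forgets intermediate results,
-- so every reversible (that is, injective) program over reads of the f i can be
-- simulated.  Disjunction and conjunction are chains of gates, parity is a
-- walk on two states.
--
-- For the majority let D = 2 Σ f i − k.  The sign of D is found by an oblivious
-- program in the style of Sinha and Thathachar, with consecutive integers as
-- moduli instead of primes.  Iterated differences of 1/x give
--   Σ_{j ≤ m} (-1)^j C(m,j) / (m + 1 + j) = 1 / N,   N = (m + 1) C(2m + 1, m),
-- so the phase D / N mod 1 is obtained by adding multiples of D modulo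
-- 48 (m + 1), 48 (m + 2), …, 48 (2m + 1) in turn, the current phase being rounded
-- to the next denominator each time; the moduli are so large that the total
-- rounding error is at most 1/48.  If |D| ≤ N / 4, then a phase away from 0
-- reveals the sign of D, and otherwise |D| ≤ N / 24, which starts the next round
-- with m − 1, as N at most sextuples with m.  There are O(log k) rounds with
-- O(log k) moduli of size O(log k).

module Submission where

open import Algebra.Properties.AbelianGroup using (∙-cancelʳ)
open import Data.Bool using (Bool; true; false; not; _∨_; _∧_; _xor_; if_then_else_)
open import Data.Bool.Properties as Boolₚ using ()
open import Data.Empty using (⊥; ⊥-elim)
open import Data.Fin using (Fin; zero; suc; toℕ; fromℕ<)
open import Data.Fin.Permutation as Perm using ()
open import Data.Fin.Permutation.Components as PC using ()
open import Data.Fin.Properties as Finₚ using ()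
open import Data.Integer as ℤ using (ℤ; +_; -[1+_])
open import Data.Integer.DivMod as ℤᵈ using ()
open import Data.Integer.Properties as ℤₚ using ()
open import Data.Integer.Tactic.RingSolver using () renaming (solve-∀ to ℤ-solve)
open import Data.Maybe as Maybe using (Maybe; just; nothing)
open import Data.Maybe.Properties using (just-injective)
open import Data.Nat as ℕ using (ℕ; zero; suc; _+_; _*_; _^_; _≤_; _<_; z≤n; s≤s; NonZero; _/_; _%_; _!)
open import Data.Nat.Divisibility as ℕ∣ using ()
open import Data.Nat.DivMod as ℕᵈ using ()
open import Data.Nat.Logarithm using (⌊log₂_⌋; ⌊log₂⌋-mono-≤; ⌊log₂[2^n]⌋≡n)
open import Data.Nat.Properties as ℕₚ using ()
open import Data.Nat.Tactic.RingSolver using () renaming (solve-∀ to ℕ-solve)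
open import Data.Product using (Σ; ∃-syntax; _×_; _,_; proj₁; proj₂)
open import Data.Product.Function.NonDependent.Propositional using (_×-↔_)
open import Data.Sum as Sum using (_⊎_; inj₁; inj₂)
open import Data.Sum.Function.Propositional using (_⊎-↔_)
open import Data.Sum.Properties using (swap-↔) renaming (≡-dec to ⊎-≡-dec)
open import Data.Unit using (⊤; tt)
open import Data.Unit.Properties as ⊤ₚ using ()
open import Data.Vec using (Vec)
open import Defs
open import Function using (_∘_; id)
open import Function.Bundles using (_↔_; mk↔ₛ′; Inverse; Equivalence)
open import Function.Construct.Composition using (_↔-∘_)
open import Function.Construct.Identity using (↔-id)
open import Relation.Binary using (DecidableEquality)
open import Relation.Binary.Definitions using (tri<; tri≈; tri>)
open import Relation.Binary.PropositionalEquality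
open import Relation.Nullary using (¬_; yes; no)

-- Paths in the union of two matchings

-- The notion of `Matching` over an arbitrary vertex set, so that networks can be assembled from
-- sums and products; they are moved to `Fin` only at the end, by `transport`.
record Pairing (V : Set) : Set where
  field
    mate        : V → Maybe V
    mate-sym    : ∀ {u v} → mate u ≡ just v → mate v ≡ just u
    mate-irrefl : ∀ {u} → mate u ≢ just u

open Pairing public

data Player : Set where
  𝐀 𝐁 : Player

opp : Player → Player
opp 𝐀 = 𝐁
opp 𝐁 = 𝐀

opp-involutive : ∀ σ → opp (opp σ) ≡ σ
opp-involutive 𝐀 = refl
opp-involutive 𝐁 = refl

nothing≢just : ∀ {A : Set} {m : Maybe A} {a} → m ≡ nothing → m ≢ just a
nothing≢just refl ()

module _ {V : Set} (E : Player → Pairing V) where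

  -- Path σ τ u v: a path from u to v whose edges alternate between the two
  -- matchings, the first edge being σ's and the last one τ's.
  data Path : Player → Player → V → V → Set where
    edge : ∀ {σ u v} → mate (E σ) u ≡ just v → Path σ σ u v
    _◂_  : ∀ {σ τ u v w} → mate (E σ) u ≡ just v → Path (opp σ) τ v w → Path σ τ u w

  infixr 5 _◂_

  -- Run σ u p: the maximal path that leaves u along σ's edge is finite, and
  -- p is the parity of its length.
  data Run : Player → V → Bool → Set where
    stop : ∀ {σ u} → mate (E σ) u ≡ nothing → Run σ u false
    step : ∀ {σ u v p} → mate (E σ) u ≡ just v → Run (opp σ) v p → Run σ u (not p)

  path-++ : ∀ {σ τ ρ u v w} → Path σ τ u v → Path (opp τ) ρ v w → Path σ ρ u w
  path-++ (edge e) q = e ◂ q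
  path-++ (e ◂ p)  q = e ◂ path-++ p q

  path-∷ʳ : ∀ {σ τ u v w} → Path σ (opp τ) u v → mate (E τ) v ≡ just w → Path σ τ u w
  path-∷ʳ {τ = 𝐀} p e = path-++ p (edge e)
  path-∷ʳ {τ = 𝐁} p e = path-++ p (edge e)

  path-reverse : ∀ {σ τ u v} → Path σ τ u v → Path τ σ v u
  path-reverse {σ} (edge e) = edge (mate-sym (E σ) e)
  path-reverse {σ} (e ◂ p)  = path-∷ʳ (path-reverse p) (mate-sym (E σ) e)

  run-unique : ∀ {σ u p q} → Run σ u p → Run σ u q → p ≡ q
  run-unique (stop _)   (stop _)    = refl
  run-unique (stop e)   (step e′ _) = ⊥-elim (nothing≢just e e′)
  run-unique (step e _) (stop e′)   = ⊥-elim (nothing≢just e′ e)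
  run-unique (step e r) (step e′ r′) with refl ← just-injective (trans (sym e) e′) =
    cong not (run-unique r r′)

  -- Edges alternate, so a path has odd length exactly when its first and last edges belong to the
  -- same player. Hence `Path` need not record lengths.
  run-odd : ∀ {σ u v p} → Path σ σ u v → Run (opp σ) v p → Run σ u (not p)
  run-even : ∀ {σ u v p} → Path σ (opp σ) u v → Run σ v p → Run σ u p
  run-odd (edge e) r = step e r
  run-odd {σ = 𝐀} (e ◂ q) r = step e (run-even q r)
  run-odd {σ = 𝐁} (e ◂ q) r = step e (run-even q r)
  run-even {𝐀} (e ◂ q) r = subst (Run _ _) (Boolₚ.not-involutive _) (step e (run-odd q r))
  run-even {𝐁} (e ◂ q) r = subst (Run _ _) (Boolₚ.not-involutive _) (step e (run-odd q r))

  module _ (t : V) (t-free : mate (E 𝐁) t ≡ nothing) where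

    -- Reach n σ u: some alternating path with n edges starts at t with an edge
    -- of 𝐀 and ends in u, the next edge being σ's.
    data Reach : ℕ → Player → V → Set where
      start  : Reach 0 𝐀 t
      extend : ∀ {n σ u v} → Reach n σ u → mate (E σ) u ≡ just v → Reach (suc n) (opp σ) v

    private
      unextend : ∀ {n σ v} → Reach (suc n) σ v →
                 ∃[ u ] Reach n (opp σ) u × mate (E (opp σ)) v ≡ just u
      unextend (extend {σ = 𝐀} {u} r e) = u , r , mate-sym (E 𝐀) e
      unextend (extend {σ = 𝐁} {u} r e) = u , r , mate-sym (E 𝐁) e

      reach-unique : ∀ {n σ τ u v} → Reach n σ u → Reach n τ v → σ ≡ τ × u ≡ v
      reach-unique start start = refl , refl
      reach-unique (extend r e) (extend r′ e′) with refl , refl ← reach-unique r r′ =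
        refl , just-injective (trans (sym e) e′)

      opp-irrefl : ∀ σ → σ ≢ opp σ
      opp-irrefl 𝐀 ()
      opp-irrefl 𝐁 ()

      -- Both visits are traced back in step until the earlier one is `start`; the later one would
      -- then enter t by an edge of `𝐁`, contrary to `t-free`.
      no-return : ∀ {n} d {σ u} → Reach n σ u → ¬ Reach (suc (d + n)) σ u
      no-return {zero} d start r′ with _ , _ , e ← unextend r′ = nothing≢just t-free e
      no-return {suc n} d {σ} r r′ with u , q , e ← unextend r | u′ , q′ , e′ ← unextend r′
        with refl ← just-injective (trans (sym e) e′) =
        no-return d q (subst (λ k → Reach k (opp σ) u) (ℕₚ.+-suc d n) q′)

      -- A path that came back to u along the edge it once left u by would
      -- traverse the loop between the two visits symmetrically from both ends.
      no-palindrome : ∀ {n} d {σ u} → Reach n σ u → ¬ Reach (suc (d + n)) (opp σ) u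
      no-palindrome zero {σ} r r′ with u′ , q , e ← unextend r′
        with _ , refl ← reach-unique r q = mate-irrefl (E (opp (opp σ))) e
      no-palindrome (suc zero) {σ} r r′ with u′ , q , e ← unextend r′
        rewrite opp-involutive σ = opp-irrefl σ (proj₁ (reach-unique q (extend r e)))
      no-palindrome {n} (suc (suc d)) {σ} r r′ with u′ , q , e ← unextend r′
        rewrite opp-involutive σ =
        no-palindrome d (extend r e)
          (subst₂ (λ k τ → Reach k τ u′) (cong suc (sym (ℕₚ.+-suc d n))) (sym (opp-involutive σ)) q)

    reach-distinct : ∀ {n m σ τ u} → n < m → Reach n σ u → ¬ Reach m τ u
    reach-distinct {n} {m} {σ} {τ} {u} n<m r r′ with ℕₚ.m≤n⇒∃[o]m+o≡n n<m
    ... | d , refl = split σ τ r (subst (λ k → Reach (suc k) τ u) (ℕₚ.+-comm n d) r′)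
      where
      split : ∀ {u} σ τ → Reach n σ u → ¬ Reach (suc (d + n)) τ u
      split 𝐀 𝐀 = no-return d
      split 𝐀 𝐁 = no-palindrome d
      split 𝐁 𝐀 = no-palindrome d
      split 𝐁 𝐁 = no-return d

    private
      truncate : ∀ {n σ u} k → k ≤ n → Reach n σ u → ∃[ τ ] ∃[ v ] Reach k τ v
      truncate k k≤n r with ℕₚ.m≤n⇒m<n∨m≡n k≤n
      truncate k k≤n r | inj₂ refl = _ , _ , r
      truncate k k≤n (extend r e) | inj₁ (s≤s k≤n′) = truncate k k≤n′ r

    -- N edges would visit N + 1 pairwise distinct vertices, against the pigeonhole principle. This
    -- is why `walkA` and `walkB` never exhaust their fuel.
    reach-bounded : ∀ {N n σ u} (code : V → Fin N) → (∀ {v w} → code v ≡ code w → v ≡ w) →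
                    Reach n σ u → n < N
    reach-bounded {N} {n} code code-inj r = ℕₚ.≰⇒> λ N≤n →
      let visit : (i : Fin (suc N)) → ∃[ τ ] ∃[ v ] Reach (toℕ i) τ v
          visit i = truncate (toℕ i) (ℕₚ.≤-trans (ℕₚ.≤-pred (Finₚ.toℕ<n i)) N≤n) r
          i , j , i<j , eq = Finₚ.pigeonhole (ℕₚ.n<1+n N) (λ i → code (proj₁ (proj₂ (visit i))))
          _ , _ , rᵢ = visit i
          τ , _ , rⱼ = visit j
      in reach-distinct i<j rᵢ (subst (Reach (toℕ j) τ) (sym (code-inj eq)) rⱼ)

map-just⁻¹ : ∀ {A B : Set} {f : A → B} (m : Maybe A) {b} →
             Maybe.map f m ≡ just b → ∃[ a ] m ≡ just a × f a ≡ b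
map-just⁻¹ (just a) refl = a , refl , refl

-- Protocols as graphs, and their output as the parity of a run

matchingPairing : ∀ {m} → Matching m → Pairing (Fin m)
matchingPairing M = record
  { mate = partner M ; mate-sym = symm M _ _ ; mate-irrefl = irrefl M _ }

pipePairing : ∀ {s} → Matching s → Pairing (Fin (suc s))
pipePairing {s} M = record { mate = mate′ ; mate-sym = λ {u} → sym′ u ; mate-irrefl = λ {u} → irr′ u }
  where
  mate′ : Fin (suc s) → Maybe (Fin (suc s))
  mate′ zero    = nothing
  mate′ (suc v) = Maybe.map suc (partner M v)

  sym′ : ∀ u {v} → mate′ u ≡ just v → mate′ v ≡ just u
  sym′ (suc u) e with v , e′ , refl ← map-just⁻¹ (partner M u) e =
    cong (Maybe.map suc) (symm M u v e′)

  irr′ : ∀ u → mate′ u ≢ just u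
  irr′ (suc u) e with _ , e′ , refl ← map-just⁻¹ (partner M u) e = irrefl M u e′

protocolGraph : ∀ {s} → Matching (suc s) → Matching s → Player → Pairing (Fin (suc s))
protocolGraph A B 𝐀 = matchingPairing A
protocolGraph A B 𝐁 = pipePairing B

xor-step : ∀ b p → not b xor p ≡ b xor not p
xor-step false p = refl
xor-step true  p = sym (Boolₚ.not-involutive p)

module _ {s : ℕ} (A : Matching (suc s)) (B : Matching s) where
  private
    E = protocolGraph A B

    -- The invariant `n + f ≡ suc s` couples the fuel to the path walked so far: without fuel that
    -- path would have `suc s` edges, which `reach-bounded` forbids.
    walkA-run : ∀ f {n u} b → n + f ≡ suc s → Reach E zero refl n 𝐀 u →
                ∃[ p ] Run E 𝐀 u p × walkA A B f u b ≡ b xor p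
    walkB-run : ∀ f {n u} b → n + f ≡ suc s → Reach E zero refl n 𝐁 u →
                ∃[ p ] Run E 𝐁 u p × walkB A B f u b ≡ b xor p
    walkA-run zero {n} b eq r =
      ⊥-elim (ℕₚ.<-irrefl (trans (sym (ℕₚ.+-identityʳ n)) eq) (reach-bounded E zero refl (λ v → v) (λ e → e) r))
    walkA-run (suc f) {n} {u} b eq r with partner A u in e
    ... | nothing = false , stop e , sym (Boolₚ.xor-identityʳ b)
    ... | just w with p , q , h ← walkB-run f (not b) (trans (sym (ℕₚ.+-suc n f)) eq) (extend r e) =
      not p , step e q , trans h (xor-step b p)
    walkB-run zero {n} b eq r =
      ⊥-elim (ℕₚ.<-irrefl (trans (sym (ℕₚ.+-identityʳ n)) eq) (reach-bounded E zero refl (λ v → v) (λ e → e) r))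
    walkB-run (suc f) {n} {zero} b eq r = false , stop refl , sym (Boolₚ.xor-identityʳ b)
    walkB-run (suc f) {n} {suc v} b eq r with partner B v in e
    ... | nothing = false , stop (cong (Maybe.map suc) e) , sym (Boolₚ.xor-identityʳ b)
    ... | just w with p , q , h ← walkA-run f (not b) (trans (sym (ℕₚ.+-suc n f)) eq) (extend r (cong (Maybe.map suc) e)) =
      not p , step (cong (Maybe.map suc) e) q , trans h (xor-step b p)

  output-run : Run E 𝐀 zero (output A B)
  output-run with p , q , h ← walkA-run (suc s) false refl start = subst (Run E 𝐀 zero) (sym h) q

-- Embeddings with decidable image, and pairings

infix 0 _↪_
-- The partial inverse is data rather than a proof of injectivity, because a matching has to compute
-- whether a vertex is a port, and which one.
record _↪_ (A B : Set) : Set where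
  field
    to      : A → B
    from    : B → Maybe A
    from-to : ∀ a → from (to a) ≡ just a
    to-from : ∀ {a b} → from b ≡ just a → to a ≡ b

open _↪_ public

↪-id : ∀ {A} → A ↪ A
↪-id = record { to = id ; from = just ; from-to = λ _ → refl ; to-from = just-injective ∘ sym }

infixr 9 _↪-∘_
_↪-∘_ : ∀ {A B C} → B ↪ C → A ↪ B → A ↪ C
_↪-∘_ {A} {B} {C} g f = record
  { to = to g ∘ to f
  ; from = λ c → from g c Maybe.>>= from f
  ; from-to = λ a → trans (cong (Maybe._>>= from f) (from-to g (to f a))) (from-to f a)
  ; to-from = λ {a} {c} → back c }
  where
  back : ∀ c {a} → (from g c Maybe.>>= from f) ≡ just a → to g (to f a) ≡ c
  back c e with from g c in e′
  ... | just b = trans (cong (to g) (to-from f e)) (to-from g e′)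

↔⇒↪ : ∀ {A B} → A ↔ B → A ↪ B
↔⇒↪ i = record
  { to = Inverse.to i
  ; from = just ∘ Inverse.from i
  ; from-to = λ a → cong just (Inverse.strictlyInverseʳ i a)
  ; to-from = λ { refl → Inverse.strictlyInverseˡ i _ } }

inj₁-↪ : ∀ {A B} → A ↪ A ⊎ B
inj₁-↪ = record
  { to = inj₁ ; from = λ { (inj₁ a) → just a ; (inj₂ _) → nothing }
  ; from-to = λ _ → refl ; to-from = λ { {b = inj₁ _} refl → refl } }

inj₂-↪ : ∀ {A B} → B ↪ A ⊎ B
inj₂-↪ = record
  { to = inj₂ ; from = λ { (inj₁ _) → nothing ; (inj₂ b) → just b }
  ; from-to = λ _ → refl ; to-from = λ { {b = inj₂ _} refl → refl } }

infixr 2 _⊎-↪_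
_⊎-↪_ : ∀ {A B C D} → A ↪ C → B ↪ D → A ⊎ B ↪ C ⊎ D
f ⊎-↪ g = record
  { to = Sum.map (to f) (to g)
  ; from = λ { (inj₁ c) → Maybe.map inj₁ (from f c) ; (inj₂ d) → Maybe.map inj₂ (from g d) }
  ; from-to = λ { (inj₁ a) → cong (Maybe.map inj₁) (from-to f a)
                ; (inj₂ b) → cong (Maybe.map inj₂) (from-to g b) }
  ; to-from = λ { {b = inj₁ c} e → left c e ; {b = inj₂ d} e → right d e } }
  where
  left : ∀ c {a} → Maybe.map inj₁ (from f c) ≡ just a → Sum.map (to f) (to g) a ≡ inj₁ c
  left c e with _ , e′ , refl ← map-just⁻¹ (from f c) e = cong inj₁ (to-from f e′)
  right : ∀ d {a} → Maybe.map inj₂ (from g d) ≡ just a → Sum.map (to f) (to g) a ≡ inj₂ d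
  right d e with _ , e′ , refl ← map-just⁻¹ (from g d) e = cong inj₂ (to-from g e′)

×-↪ : ∀ A {B C} → B ↪ C → A × B ↪ A × C
×-↪ A f = record
  { to = λ (a , b) → a , to f b
  ; from = λ (a , c) → Maybe.map (a ,_) (from f c)
  ; from-to = λ (a , b) → cong (Maybe.map (a ,_)) (from-to f b)
  ; to-from = λ {_} {c} → back c }
  where
  back : ∀ p {q} → Maybe.map (proj₁ p ,_) (from f (proj₂ p)) ≡ just q → (proj₁ q , to f (proj₂ q)) ≡ p
  back (a , c) e with _ , e′ , refl ← map-just⁻¹ (from f c) e = cong (a ,_) (to-from f e′)

×⊤-↪ : ∀ {A : Set} → A ↪ A × ⊤
×⊤-↪ = ↔⇒↪ (mk↔ₛ′ (_, tt) proj₁ (λ _ → refl) (λ _ → refl))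

-- However far `f` is from injective, keeping the argument next to its value makes the map
-- reversible.
graph-↪ : ∀ {A C} → DecidableEquality C → (A → C) → A ↪ C × A
graph-↪ {A} {C} _≟_ f = record
  { to = λ a → f a , a ; from = back ; from-to = from-to′ ; to-from = λ {_} {b} → to-from′ b }
  where
  back : C × A → Maybe A
  back (c , a) with c ≟ f a
  ... | yes _ = just a
  ... | no  _ = nothing
  from-to′ : ∀ a → back (f a , a) ≡ just a
  from-to′ a with f a ≟ f a
  ... | yes _ = refl
  ... | no ≢  = ⊥-elim (≢ refl)
  to-from′ : ∀ b {a} → back b ≡ just a → (f a , a) ≡ b
  to-from′ (c , a) e with c ≟ f a
  to-from′ (c , a) refl | yes refl = refl

point-↪ : ∀ {A} → DecidableEquality A → A → ⊤ ↪ A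
point-↪ {A} _≟_ a = record
  { to = λ _ → a ; from = back ; from-to = λ _ → from-to′ ; to-from = λ {_} {b} → to-from′ b }
  where
  back : A → Maybe ⊤
  back b with a ≟ b
  ... | yes _ = just tt
  ... | no  _ = nothing
  from-to′ : back a ≡ just tt
  from-to′ with a ≟ a
  ... | yes _ = refl
  ... | no ≢  = ⊥-elim (≢ refl)
  to-from′ : ∀ b {t} → back b ≡ just t → a ≡ b
  to-from′ b e with a ≟ b
  ... | yes a≡b = a≡b

Fin-↪ : ∀ {m n} (f : Fin m → Fin n) → (∀ {i j} → f i ≡ f j → i ≡ j) → Fin m ↪ Fin n
Fin-↪ {m} {n} f f-inj = record
  { to = f ; from = back ; from-to = from-to′ ; to-from = λ {_} {b} → to-from′ b }
  where
  back : Fin n → Maybe (Fin m)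
  back j with Finₚ.any? (λ i → f i Finₚ.≟ j)
  ... | yes (i , _) = just i
  ... | no  _       = nothing
  from-to′ : ∀ i → back (f i) ≡ just i
  from-to′ i with Finₚ.any? (λ i′ → f i′ Finₚ.≟ f i)
  ... | yes (_ , e) = cong just (f-inj e)
  ... | no ∄        = ⊥-elim (∄ (i , refl))
  to-from′ : ∀ j {i} → back j ≡ just i → f i ≡ j
  to-from′ j e with Finₚ.any? (λ i → f i Finₚ.≟ j)
  to-from′ j refl | yes (_ , e) = e

emptyPairing : ∀ {V} → Pairing V
emptyPairing = record { mate = λ _ → nothing ; mate-sym = λ () ; mate-irrefl = λ () }

sumPairing : ∀ {V W} → Pairing V → Pairing W → Pairing (V ⊎ W)
sumPairing {V} {W} M N = record
  { mate = mate′ ; mate-sym = λ {u} → sym′ u ; mate-irrefl = λ {u} → irr′ u }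
  where
  mate′ : V ⊎ W → Maybe (V ⊎ W)
  mate′ (inj₁ v) = Maybe.map inj₁ (mate M v)
  mate′ (inj₂ w) = Maybe.map inj₂ (mate N w)
  sym′ : ∀ u {v} → mate′ u ≡ just v → mate′ v ≡ just u
  sym′ (inj₁ u) e with _ , e′ , refl ← map-just⁻¹ (mate M u) e = cong (Maybe.map inj₁) (mate-sym M e′)
  sym′ (inj₂ u) e with _ , e′ , refl ← map-just⁻¹ (mate N u) e = cong (Maybe.map inj₂) (mate-sym N e′)
  irr′ : ∀ u → mate′ u ≢ just u
  irr′ (inj₁ u) e with _ , e′ , refl ← map-just⁻¹ (mate M u) e = mate-irrefl M e′
  irr′ (inj₂ u) e with _ , e′ , refl ← map-just⁻¹ (mate N u) e = mate-irrefl N e′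

copiesPairing : ∀ A {V} → Pairing V → Pairing (A × V)
copiesPairing A {V} M = record
  { mate = mate′ ; mate-sym = λ {u} → sym′ u ; mate-irrefl = λ {u} → irr′ u }
  where
  mate′ : A × V → Maybe (A × V)
  mate′ (a , v) = Maybe.map (a ,_) (mate M v)
  sym′ : ∀ u {v} → mate′ u ≡ just v → mate′ v ≡ just u
  sym′ (a , u) e with _ , e′ , refl ← map-just⁻¹ (mate M u) e = cong (Maybe.map (a ,_)) (mate-sym M e′)
  irr′ : ∀ u → mate′ u ≢ just u
  irr′ (a , u) e with _ , e′ , refl ← map-just⁻¹ (mate M u) e = mate-irrefl M e′

unionPairing : ∀ {V} (M N : Pairing V) → (∀ u {v} → mate N u ≡ just v → mate M u ≡ nothing) → Pairing V
unionPairing {V} M N disjoint = record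
  { mate = mate′ ; mate-sym = sym′ ; mate-irrefl = irr′ }
  where
  mate′ : V → Maybe V
  mate′ u = mate M u Maybe.<∣> mate N u
  sym′ : ∀ {u v} → mate′ u ≡ just v → mate′ v ≡ just u
  sym′ {u} e with mate M u in eM
  sym′ {u} refl | just v rewrite mate-sym M eM = refl
  sym′ {u} e | nothing with e′ ← mate-sym N e rewrite disjoint _ e′ = e′
  irr′ : ∀ {u} → mate′ u ≢ just u
  irr′ {u} e with mate M u in eM
  irr′ {u} refl | just v = mate-irrefl M eM
  irr′ {u} e | nothing = mate-irrefl N e

module _ {V : Set} (M N : Pairing V) (disjoint : ∀ u {v} → mate N u ≡ just v → mate M u ≡ nothing) where

  union-left : ∀ u {v} → mate M u ≡ just v → mate (unionPairing M N disjoint) u ≡ just v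
  union-left u e rewrite e = refl

  union-right : ∀ u {v} → mate N u ≡ just v → mate (unionPairing M N disjoint) u ≡ just v
  union-right u e rewrite disjoint u e = e

  union-free : ∀ u → mate M u ≡ nothing → mate N u ≡ nothing → mate (unionPairing M N disjoint) u ≡ nothing
  union-free u e e′ rewrite e = e′

bridgePairing : ∀ {M V W} → M ↪ V → M ↪ W → Pairing (V ⊎ W)
bridgePairing {M} {V} {W} f g = record
  { mate = mate′ ; mate-sym = λ {u} → sym′ u ; mate-irrefl = λ {u} → irr′ u }
  where
  mate′ : V ⊎ W → Maybe (V ⊎ W)
  mate′ (inj₁ v) = Maybe.map (inj₂ ∘ to g) (from f v)
  mate′ (inj₂ w) = Maybe.map (inj₁ ∘ to f) (from g w)
  sym′ : ∀ u {v} → mate′ u ≡ just v → mate′ v ≡ just u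
  sym′ (inj₁ u) e with m , e′ , refl ← map-just⁻¹ (from f u) e =
    trans (cong (Maybe.map _) (from-to g m)) (cong (just ∘ inj₁) (to-from f e′))
  sym′ (inj₂ u) e with m , e′ , refl ← map-just⁻¹ (from g u) e =
    trans (cong (Maybe.map _) (from-to f m)) (cong (just ∘ inj₂) (to-from g e′))
  irr′ : ∀ u → mate′ u ≢ just u
  irr′ (inj₁ u) e with _ , _ , () ← map-just⁻¹ (from f u) e
  irr′ (inj₂ u) e with _ , _ , () ← map-just⁻¹ (from g u) e

path-map : ∀ {V W} {E : Player → Pairing V} {F : Player → Pairing W} (h : V → W) →
           (∀ σ {u v} → mate (E σ) u ≡ just v → mate (F σ) (h u) ≡ just (h v)) →
           ∀ {σ τ u v} → Path E σ τ u v → Path F σ τ (h u) (h v)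
path-map h hom (edge {σ} e) = edge (hom σ e)
path-map h hom (_◂_ {σ} e p) = hom σ e ◂ path-map h hom p

-- Composable pieces of a garden hose network

joint : ∀ {X V : Set} → (Player → X → Pairing V) → X → X → Player → Pairing V
joint edges x y 𝐀 = edges 𝐀 x
joint edges x y 𝐁 = edges 𝐁 y

-- Port vertices carry no edge of Bob, so that paths between two ports start
-- and end with an edge of Alice, and boxes are plugged together by edges of Bob.
record Box (n : ℕ) (I O : Set) : Set₁ where
  field
    size      : ℕ
    Vertex    : Set
    finite    : Fin size ↔ Vertex
    edges     : Player → Vec Bool n → Pairing Vertex
    port      : I ⊎ O ↪ Vertex
    port-free : ∀ y p → mate (edges 𝐁 y) (to port p) ≡ nothing

  graph : Vec Bool n → Vec Bool n → Player → Pairing Vertex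
  graph = joint edges

  Leads : Vec Bool n → Vec Bool n → I → O → Set
  Leads x y i o = Path (graph x y) 𝐀 𝐀 (to port (inj₁ i)) (to port (inj₂ o))

open Box public

module _ {n : ℕ} where

  wire : ∀ {a} {A : Set} → Fin a ↔ A → Box n A A
  wire {a} {A} fin = record
    { size = a + a
    ; Vertex = A ⊎ A
    ; finite = (fin ⊎-↔ fin) ↔-∘ Finₚ.+↔⊎
    ; edges = λ { 𝐀 _ → bridgePairing ↪-id ↪-id ; 𝐁 _ → emptyPairing }
    ; port = ↪-id
    ; port-free = λ _ _ → refl }

  wire-leads : ∀ {a A} (fin : Fin a ↔ A) {x y} i → Leads (wire fin) x y i i
  wire-leads fin i = edge refl

  -- Pipes have no direction, so exchanging the roles of the ports inverts a box without changing
  -- its graph.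
  rev : ∀ {I O} → Box n I O → Box n O I
  rev b = record
    { size = size b ; Vertex = Vertex b ; finite = finite b ; edges = edges b
    ; port = port b ↪-∘ ↔⇒↪ swap-↔
    ; port-free = λ y p → port-free b y (Sum.swap p) }

  rev-leads : ∀ {I O} (b : Box n I O) {x y i o} → Leads b x y i o → Leads (rev b) x y o i
  rev-leads b {x} {y} p = path-map id hom (path-reverse (graph b x y) p)
    where
    hom : ∀ σ {u v} → mate (graph b x y σ) u ≡ just v → mate (graph (rev b) x y σ) u ≡ just v
    hom 𝐀 e = e
    hom 𝐁 e = e

  -- An injective map between states costs no pipes, as it only renames ports. Ports outside the
  -- image turn into inner vertices without an edge of Bob.
  relabel : ∀ {I O I′ O′} → (I′ ↪ I) → (O′ ↪ O) → Box n I O → Box n I′ O′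
  relabel f g b = record
    { size = size b ; Vertex = Vertex b ; finite = finite b ; edges = edges b
    ; port = port b ↪-∘ (f ⊎-↪ g)
    ; port-free = λ y p → port-free b y _ }

  relabel-path : ∀ {I O I′ O′} (f : I′ ↪ I) (g : O′ ↪ O) (b : Box n I O) {x y σ τ u v} →
                 Path (graph b x y) σ τ u v → Path (graph (relabel f g b) x y) σ τ u v
  relabel-path f g b = path-map id λ { 𝐀 e → e ; 𝐁 e → e }

  relabel-leads : ∀ {I O I′ O′} (f : I′ ↪ I) (g : O′ ↪ O) (b : Box n I O) {x y i o} →
                  Leads b x y (to f i) (to g o) → Leads (relabel f g b) x y i o
  relabel-leads f g b p = relabel-path f g b p

  ⊎-interchange : ∀ {A B C D : Set} → ((A ⊎ B) ⊎ (C ⊎ D)) ↔ ((A ⊎ C) ⊎ (B ⊎ D))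
  ⊎-interchange = mk↔ₛ′ swap swap swap-swap swap-swap
    where
    swap : ∀ {A B C D : Set} → (A ⊎ B) ⊎ (C ⊎ D) → (A ⊎ C) ⊎ (B ⊎ D)
    swap (inj₁ (inj₁ a)) = inj₁ (inj₁ a)
    swap (inj₁ (inj₂ b)) = inj₂ (inj₁ b)
    swap (inj₂ (inj₁ c)) = inj₁ (inj₂ c)
    swap (inj₂ (inj₂ d)) = inj₂ (inj₂ d)
    swap-swap : ∀ {A B C D : Set} (p : (A ⊎ B) ⊎ (C ⊎ D)) → swap (swap p) ≡ p
    swap-swap (inj₁ (inj₁ a)) = refl
    swap-swap (inj₁ (inj₂ b)) = refl
    swap-swap (inj₂ (inj₁ c)) = refl
    swap-swap (inj₂ (inj₂ d)) = refl

  ×-⊎-distrib : ∀ {A B C : Set} → ((A × B) ⊎ (A × C)) ↔ (A × (B ⊎ C))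
  ×-⊎-distrib = mk↔ₛ′
    (λ { (inj₁ (a , b)) → a , inj₁ b ; (inj₂ (a , c)) → a , inj₂ c })
    (λ { (a , inj₁ b) → inj₁ (a , b) ; (a , inj₂ c) → inj₂ (a , c) })
    (λ { (_ , inj₁ _) → refl ; (_ , inj₂ _) → refl })
    (λ { (inj₁ _) → refl ; (inj₂ _) → refl })

  infixr 4 _∥_
  _∥_ : ∀ {I O I′ O′} → Box n I O → Box n I′ O′ → Box n (I ⊎ I′) (O ⊎ O′)
  b ∥ c = record
    { size = size b + size c
    ; Vertex = Vertex b ⊎ Vertex c
    ; finite = (finite b ⊎-↔ finite c) ↔-∘ Finₚ.+↔⊎
    ; edges = λ σ x → sumPairing (edges b σ x) (edges c σ x)
    ; port = (port b ⊎-↪ port c) ↪-∘ ↔⇒↪ ⊎-interchange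
    ; port-free = λ { y (inj₁ (inj₁ i)) → cong (Maybe.map inj₁) (port-free b y _)
                    ; y (inj₁ (inj₂ i)) → cong (Maybe.map inj₂) (port-free c y _)
                    ; y (inj₂ (inj₁ i)) → cong (Maybe.map inj₁) (port-free b y _)
                    ; y (inj₂ (inj₂ i)) → cong (Maybe.map inj₂) (port-free c y _) } }

  module _ {I O I′ O′} (b : Box n I O) (c : Box n I′ O′) {x y : Vec Bool n} where

    ∥-leadsˡ : ∀ {i o} → Leads b x y i o → Leads (b ∥ c) x y (inj₁ i) (inj₁ o)
    ∥-leadsˡ = path-map inj₁ λ { 𝐀 e → cong (Maybe.map inj₁) e ; 𝐁 e → cong (Maybe.map inj₁) e }

    ∥-leadsʳ : ∀ {i o} → Leads c x y i o → Leads (b ∥ c) x y (inj₂ i) (inj₂ o)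
    ∥-leadsʳ = path-map inj₂ λ { 𝐀 e → cong (Maybe.map inj₂) e ; 𝐁 e → cong (Maybe.map inj₂) e }

  copies : ∀ {a A I O} → Fin a ↔ A → Box n I O → Box n (A × I) (A × O)
  copies {a} {A} fin b = record
    { size = a * size b
    ; Vertex = A × Vertex b
    ; finite = (fin ×-↔ finite b) ↔-∘ Finₚ.*↔×
    ; edges = λ σ x → copiesPairing A (edges b σ x)
    ; port = ×-↪ A (port b) ↪-∘ ↔⇒↪ ×-⊎-distrib
    ; port-free = λ { y (inj₁ (a , i)) → cong (Maybe.map (a ,_)) (port-free b y _)
                    ; y (inj₂ (a , o)) → cong (Maybe.map (a ,_)) (port-free b y _) } }

  copies-leads : ∀ {a A I O} (fin : Fin a ↔ A) (b : Box n I O) {x y} j {i o} →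
                 Leads b x y i o → Leads (copies fin b) x y (j , i) (j , o)
  copies-leads fin b j = path-map (j ,_) λ { 𝐀 e → cong (Maybe.map (j ,_)) e ; 𝐁 e → cong (Maybe.map (j ,_)) e }

  module _ {I M O} (b : Box n I M) (c : Box n M O) where
    private
      exit : M ↪ Vertex b
      exit = port b ↪-∘ inj₂-↪
      entry : M ↪ Vertex c
      entry = port c ↪-∘ inj₁-↪

      inside : Vec Bool n → Pairing (Vertex b ⊎ Vertex c)
      inside y = sumPairing (edges b 𝐁 y) (edges c 𝐁 y)

      bridge : Pairing (Vertex b ⊎ Vertex c)
      bridge = bridgePairing exit entry

      disjoint : ∀ y u {v} → mate bridge u ≡ just v → mate (inside y) u ≡ nothing
      disjoint y (inj₁ u) e with m , e′ , _ ← map-just⁻¹ (from exit u) e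
        rewrite sym (to-from exit e′) = cong (Maybe.map inj₁) (port-free b y (inj₂ m))
      disjoint y (inj₂ u) e with m , e′ , _ ← map-just⁻¹ (from entry u) e
        rewrite sym (to-from entry e′) = cong (Maybe.map inj₂) (port-free c y (inj₁ m))

      plugged : Player → Vec Bool n → Pairing (Vertex b ⊎ Vertex c)
      plugged 𝐀 x = sumPairing (edges b 𝐀 x) (edges c 𝐀 x)
      plugged 𝐁 y = unionPairing (inside y) bridge (disjoint y)

      outer : I ⊎ O ↪ Vertex b ⊎ Vertex c
      outer = (port b ↪-∘ inj₁-↪) ⊎-↪ (port c ↪-∘ inj₂-↪)

      outer-free : ∀ y p → mate (plugged 𝐁 y) (to outer p) ≡ nothing
      outer-free y p = union-free (inside y) bridge (disjoint y) (to outer p) (inside-free p) (bridge-free p)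
        where
        inside-free : ∀ p → mate (inside y) (to outer p) ≡ nothing
        inside-free (inj₁ i) = cong (Maybe.map inj₁) (port-free b y (inj₁ i))
        inside-free (inj₂ o) = cong (Maybe.map inj₂) (port-free c y (inj₂ o))
        bridge-free : ∀ p → mate bridge (to outer p) ≡ nothing
        bridge-free (inj₁ i) rewrite from-to (port b) (inj₁ i) = refl
        bridge-free (inj₂ o) rewrite from-to (port c) (inj₂ o) = refl

    infixr 5 _⨾_
    _⨾_ : Box n I O
    _⨾_ = record
      { size = size b + size c
      ; Vertex = Vertex b ⊎ Vertex c
      ; finite = (finite b ⊎-↔ finite c) ↔-∘ Finₚ.+↔⊎
      ; edges = plugged
      ; port = outer
      ; port-free = outer-free }

    module _ {x y : Vec Bool n} where

      ⨾-pathˡ : ∀ {σ τ u v} → Path (graph b x y) σ τ u v → Path (graph _⨾_ x y) σ τ (inj₁ u) (inj₁ v)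
      ⨾-pathˡ = path-map inj₁ λ
        { 𝐀 e → cong (Maybe.map inj₁) e
        ; 𝐁 {u} e → union-left (inside y) bridge (disjoint y) (inj₁ u) (cong (Maybe.map inj₁) e) }

      ⨾-pathʳ : ∀ {σ τ u v} → Path (graph c x y) σ τ u v → Path (graph _⨾_ x y) σ τ (inj₂ u) (inj₂ v)
      ⨾-pathʳ = path-map inj₂ λ
        { 𝐀 e → cong (Maybe.map inj₂) e
        ; 𝐁 {u} e → union-left (inside y) bridge (disjoint y) (inj₂ u) (cong (Maybe.map inj₂) e) }

      ⨾-edge : ∀ m → mate (graph _⨾_ x y 𝐁) (inj₁ (to exit m)) ≡ just (inj₂ (to entry m))
      ⨾-edge m = union-right (inside y) bridge (disjoint y) (inj₁ (to exit m))
        (cong (Maybe.map (inj₂ ∘ to entry)) (from-to exit m))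

      ⨾-leads : ∀ {i m o} → Leads b x y i m → Leads c x y m o → Leads _⨾_ x y i o
      ⨾-leads {m = m} p q = path-++ (graph _⨾_ x y) (⨾-pathˡ p) (⨾-edge m ◂ ⨾-pathʳ q)

      ⨾-dead : ∀ {v} → mate (edges b 𝐁 y) v ≡ nothing → from (port b ↪-∘ inj₂-↪) v ≡ nothing →
               mate (graph _⨾_ x y 𝐁) (inj₁ v) ≡ nothing
      ⨾-dead {v} e e′ = union-free (inside y) bridge (disjoint y) (inj₁ v)
        (cong (Maybe.map inj₁) e) (cong (Maybe.map (inj₂ ∘ to entry)) e′)

-- From protocols to boxes and back

bool-guard : ∀ {A : Set} {b : Bool} {m : Maybe A} {a} →
             (if b then m else nothing) ≡ just a → b ≡ true × m ≡ just a
bool-guard {b = true} e = refl , e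

fibrePairing : ∀ {C U} → Pairing C → (U → Bool) → Pairing (C × U)
fibrePairing {C} {U} T on = record
  { mate = mate′ ; mate-sym = λ {u} → sym′ u ; mate-irrefl = λ {u} → irr′ u }
  where
  mate′ : C × U → Maybe (C × U)
  mate′ (c , u) = if on u then Maybe.map (_, u) (mate T c) else nothing
  sym′ : ∀ p {q} → mate′ p ≡ just q → mate′ q ≡ just p
  sym′ (c , u) e with on≡ , e′ ← bool-guard {b = on u} e
    with d , e″ , refl ← map-just⁻¹ (mate T c) e′ rewrite on≡ | mate-sym T e″ = refl
  irr′ : ∀ p → mate′ p ≢ just p
  irr′ (c , u) e with _ , e′ ← bool-guard {b = on u} e
    with d , e″ , refl ← map-just⁻¹ (mate T c) e′ = mate-irrefl T e″

-- nothing is the copy in which the path of the protocol is run forwards;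
-- in the copy just σ it is run backwards, if it got stuck for want of an edge of σ.
Copy : Set
Copy = Maybe Player

3↔Copy : Fin 3 ↔ Copy
3↔Copy = mk↔ₛ′
  (λ { zero → nothing ; (suc zero) → just 𝐀 ; (suc (suc zero)) → just 𝐁 })
  (λ { nothing → zero ; (just 𝐀) → suc zero ; (just 𝐁) → suc (suc zero) })
  (λ { nothing → refl ; (just 𝐀) → refl ; (just 𝐁) → refl })
  (λ { zero → refl ; (suc zero) → refl ; (suc (suc zero)) → refl })

turn : Player → Pairing Copy
turn σ = record { mate = mate′ σ ; mate-sym = λ {c} → sym′ σ c ; mate-irrefl = λ {c} → irr′ σ c }
  where
  mate′ : Player → Copy → Maybe Copy
  mate′ σ nothing = just (just σ)
  mate′ 𝐀 (just 𝐀) = just nothing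
  mate′ 𝐀 (just 𝐁) = nothing
  mate′ 𝐁 (just 𝐀) = nothing
  mate′ 𝐁 (just 𝐁) = just nothing
  sym′ : ∀ σ c {d} → mate′ σ c ≡ just d → mate′ σ d ≡ just c
  sym′ 𝐀 nothing refl = refl
  sym′ 𝐁 nothing refl = refl
  sym′ 𝐀 (just 𝐀) refl = refl
  sym′ 𝐁 (just 𝐁) refl = refl
  irr′ : ∀ σ c → mate′ σ c ≢ just c
  irr′ 𝐀 nothing ()
  irr′ 𝐁 nothing ()
  irr′ 𝐀 (just 𝐀) ()
  irr′ 𝐁 (just 𝐁) ()

module _ {n s : ℕ} (P : Protocol n s) where
  private
    part : Player → Vec Bool n → Pairing (Fin (suc s))
    part 𝐀 x = matchingPairing (alice P x)
    part 𝐁 y = pipePairing (bob P y)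

    -- The copies of the tap are the ports of the gate and must stay free of Bob's edges, hence the
    -- exception for `𝐁` at `zero`.
    turnable : Player → Vec Bool n → Fin (suc s) → Bool
    turnable 𝐁 y zero = false
    turnable σ x u    = Maybe.is-nothing (mate (part σ x) u)

    turnable⇒free : ∀ σ x u → turnable σ x u ≡ true → mate (part σ x) u ≡ nothing
    turnable⇒free 𝐀 x u e with partner (alice P x) u
    ... | nothing = refl
    turnable⇒free 𝐁 y (suc u) e with mate (part 𝐁 y) (suc u)
    ... | nothing = refl

    free⇒turnable : ∀ σ x u → (σ , u) ≢ (𝐁 , zero) → mate (part σ x) u ≡ nothing → turnable σ x u ≡ true
    free⇒turnable 𝐀 x u       _ e = cong Maybe.is-nothing e
    free⇒turnable 𝐁 y zero    ne e = ⊥-elim (ne refl)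
    free⇒turnable 𝐁 y (suc u) _ e = cong Maybe.is-nothing e

    forth-and-back turns : Player → Vec Bool n → Pairing (Copy × Fin (suc s))
    forth-and-back σ x = copiesPairing Copy (part σ x)
    turns σ x = fibrePairing (turn σ) (turnable σ x)

    disjoint : ∀ σ x u {v} → mate (turns σ x) u ≡ just v → mate (forth-and-back σ x) u ≡ nothing
    disjoint σ x (c , u) e with on , _ ← bool-guard {b = turnable σ x u} e =
      cong (Maybe.map (c ,_)) (turnable⇒free σ x u on)

    -- A path of even length gets stuck for want of an edge of Alice, one of odd length for want of
    -- an edge of Bob. Hence the copy `just 𝐀` is the exit for `false` and `just 𝐁` the one for
    -- `true`.
    tap-port : ⊤ ⊎ Bool ↪ Copy × Fin (suc s)
    tap-port = record
      { to = λ p → copy p , zero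
      ; from = λ { (c , zero) → just (uncopy c) ; (_ , suc _) → nothing }
      ; from-to = λ { (inj₁ tt) → refl ; (inj₂ false) → refl ; (inj₂ true) → refl }
      ; to-from = λ { {b = nothing , zero} refl → refl ; {b = just 𝐀 , zero} refl → refl
                    ; {b = just 𝐁 , zero} refl → refl } }
      where
      copy : ⊤ ⊎ Bool → Copy
      copy (inj₁ tt)    = nothing
      copy (inj₂ false) = just 𝐀
      copy (inj₂ true)  = just 𝐁
      uncopy : Copy → ⊤ ⊎ Bool
      uncopy nothing  = inj₁ tt
      uncopy (just 𝐀) = inj₂ false
      uncopy (just 𝐁) = inj₂ true

  gate : Box n ⊤ Bool
  gate = record
    { size = 3 * suc s
    ; Vertex = Copy × Fin (suc s)
    ; finite = (3↔Copy ×-↔ ↔-id _) ↔-∘ Finₚ.*↔×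
    ; edges = λ σ x → unionPairing (forth-and-back σ x) (turns σ x) (disjoint σ x)
    ; port = tap-port
    ; port-free = λ { _ (inj₁ tt) → refl ; _ (inj₂ false) → refl ; _ (inj₂ true) → refl } }

  module _ (x y : Vec Bool n) where
    private
      E : Player → Pairing (Fin (suc s))
      E = protocolGraph (alice P x) (bob P y)

      forth : ∀ σ c {u v} → mate (E σ) u ≡ just v → mate (graph gate x y σ) (c , u) ≡ just (c , v)
      forth 𝐀 c {u} e = union-left (forth-and-back 𝐀 x) (turns 𝐀 x) (disjoint 𝐀 x) (c , u) (cong (Maybe.map (c ,_)) e)
      forth 𝐁 c {u} e = union-left (forth-and-back 𝐁 y) (turns 𝐁 y) (disjoint 𝐁 y) (c , u) (cong (Maybe.map (c ,_)) e)

      turn-mate : ∀ σ z u → turnable σ z u ≡ true → mate (turns σ z) (nothing , u) ≡ just (just σ , u)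
      turn-mate σ z u e rewrite e = refl

      turn-back : ∀ σ u → (σ , u) ≢ (𝐁 , zero) → mate (E σ) u ≡ nothing →
                  mate (graph gate x y σ) (nothing , u) ≡ just (just σ , u)
      turn-back 𝐀 u u≢tap e = union-right (forth-and-back 𝐀 x) (turns 𝐀 x) (disjoint 𝐀 x) (nothing , u)
        (turn-mate 𝐀 x u (free⇒turnable 𝐀 x u u≢tap e))
      turn-back 𝐁 u u≢tap e = union-right (forth-and-back 𝐁 y) (turns 𝐁 y) (disjoint 𝐁 y) (nothing , u)
        (turn-mate 𝐁 y u (free⇒turnable 𝐁 y u u≢tap e))

      last : Player → Bool → Player
      last σ false = σ
      last σ true  = opp σ

      last-not : ∀ σ p → last (opp σ) p ≡ last σ (not p)
      last-not σ false = refl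
      last-not σ true  = opp-involutive σ

      -- Induction on the run: an edge taken forwards in the copy `nothing` is retraced after the
      -- turn in the other copy. `Reach` excludes that the path gets stuck at the tap for want of an
      -- edge of Bob, where no turn is possible.
      there-and-back : ∀ {k σ u p} → Reach E zero refl k σ u → Run E σ u p →
                       Path (graph gate x y) σ σ (nothing , u) (just (last σ p) , u)
      there-and-back {k} {σ} {u} r (stop e) = edge (turn-back σ u (not-tap r) e)
        where
        not-tap : ∀ {k σ u} → Reach E zero refl k σ u → (σ , u) ≢ (𝐁 , zero)
        not-tap {suc k} r refl = reach-distinct E zero refl (s≤s z≤n) start r
      there-and-back {σ = σ} {u} r (step {v = v} {p} e q) =
        forth σ nothing e ◂ path-∷ʳ (graph gate x y)
          (subst (λ τ → Path (graph gate x y) (opp σ) (opp σ) (nothing , v) (just τ , v))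
                 (last-not σ p) (there-and-back (extend r e) q))
          (forth σ _ (mate-sym (E σ) e))

    gate-leads : Leads gate x y tt (output (alice P x) (bob P y))
    gate-leads with output (alice P x) (bob P y) | output-run (alice P x) (bob P y)
    ... | false | r = there-and-back start r
    ... | true  | r = there-and-back start r

module _ {n : ℕ} where

  private
    reconverge : ∀ {c C O} → Fin c ↔ C → DecidableEquality C → (O → C) → Box n ⊤ O → Box n O C
    reconverge fin _≟_ cls b = relabel (graph-↪ _≟_ cls) ×⊤-↪ (copies fin (rev b))

  -- The paths with outcomes of the same class are brought together by running
  -- the box backwards in a copy reserved for that class.
  classify : ∀ {c C O} → Fin c ↔ C → DecidableEquality C → (O → C) → Box n ⊤ O → Box n ⊤ C
  classify fin _≟_ cls b = b ⨾ reconverge fin _≟_ cls b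

  classify-leads : ∀ {c C O} (fin : Fin c ↔ C) (_≟_ : DecidableEquality C) (cls : O → C) (b : Box n ⊤ O) {x y o} →
                   Leads b x y tt o → Leads (classify fin _≟_ cls b) x y tt (cls o)
  classify-leads fin _≟_ cls b {o = o} p = ⨾-leads b (reconverge fin _≟_ cls b) p
    (relabel-leads (graph-↪ _≟_ cls) ×⊤-↪ (copies fin (rev b)) (copies-leads fin (rev b) (cls o) (rev-leads b p)))

run-map : ∀ {V W} {E : Player → Pairing V} {F : Player → Pairing W} (h : V → W) →
          (∀ σ u → mate (F σ) (h u) ≡ Maybe.map h (mate (E σ) u)) →
          ∀ {σ u p} → Run E σ u p → Run F σ (h u) p
run-map h hom (stop {σ} {u} e)   = stop (trans (hom σ u) (cong (Maybe.map h) e))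
run-map h hom (step {σ} {u} e r) = step (trans (hom σ u) (cong (Maybe.map h) e)) (run-map h hom r)

transport : ∀ {V m} → Fin m ↔ V → Pairing V → Pairing (Fin m)
transport {V} {m} fin M = record { mate = mate′ ; mate-sym = sym′ ; mate-irrefl = irr′ }
  where
  open Inverse fin renaming (to to decode; from to encode)
  mate′ : Fin m → Maybe (Fin m)
  mate′ i = Maybe.map encode (mate M (decode i))
  sym′ : ∀ {i j} → mate′ i ≡ just j → mate′ j ≡ just i
  sym′ {i} e with v , e′ , refl ← map-just⁻¹ (mate M (decode i)) e
    rewrite strictlyInverseˡ v | mate-sym M e′ = cong just (strictlyInverseʳ i)
  irr′ : ∀ {i} → mate′ i ≢ just i
  irr′ {i} e with v , e′ , refl ← map-just⁻¹ (mate M (decode i)) e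
    rewrite strictlyInverseˡ v = mate-irrefl M e′

toMatching : ∀ {m} → Pairing (Fin m) → Matching m
toMatching M = record { partner = mate M ; symm = λ _ _ → mate-sym M ; irrefl = λ _ → mate-irrefl M }

dropTap : ∀ {s} → Pairing (Fin (suc s)) → Matching s
dropTap {s} M = record { partner = mate′ ; symm = sym′ ; irrefl = irr′ }
  where
  pred : Fin (suc s) → Maybe (Fin s)
  pred zero    = nothing
  pred (suc v) = just v
  mate′ : Fin s → Maybe (Fin s)
  mate′ u = mate M (suc u) Maybe.>>= pred
  suc-mate : ∀ u {v} → mate′ u ≡ just v → mate M (suc u) ≡ just (suc v)
  suc-mate u e with mate M (suc u)
  suc-mate u refl | just (suc v) = refl
  sym′ : ∀ u v → mate′ u ≡ just v → mate′ v ≡ just u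
  sym′ u v e rewrite mate-sym M (suc-mate u e) = refl
  irr′ : ∀ u → mate′ u ≢ just u
  irr′ u e = mate-irrefl M (suc-mate u e)

pipes-dropTap : ∀ {s} (M : Pairing (Fin (suc s))) → mate M zero ≡ nothing →
                ∀ u → mate (pipePairing (dropTap M)) u ≡ mate M u
pipes-dropTap M free zero = sym free
pipes-dropTap M free (suc u) with mate M (suc u) in e
... | nothing      = refl
... | just zero    = ⊥-elim (nothing≢just free (mate-sym M e))
... | just (suc v) = refl

-- The numbering of the vertices carries the run of the graph to a run of the protocol; `run-unique`
-- then identifies its parity with the output.
protocol-from-graph : ∀ {n s} {V : Set} (fin : Fin (suc s) ↔ V) (edges : Player → Vec Bool n → Pairing V) →
  let tap = Inverse.to fin zero in
  (∀ y → mate (edges 𝐁 y) tap ≡ nothing) →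
  (h : Fn n) →
  (∀ x y → Run (joint edges x y) 𝐀 tap (h x y)) →
  HasGH h s
protocol-from-graph {n} {s} {V} fin edges free h run = P , computes
  where
  open Inverse fin renaming (to to decode; from to encode)
  P : Protocol n s
  P = record { alice = λ x → toMatching (transport fin (edges 𝐀 x))
             ; bob   = λ y → dropTap (transport fin (edges 𝐁 y)) }
  computes : Computes P h
  computes x y = run-unique (protocolGraph (alice P x) (bob P y)) (output-run (alice P x) (bob P y))
    (subst (λ t → Run (protocolGraph (alice P x) (bob P y)) 𝐀 t (h x y)) (strictlyInverseʳ zero)
      (run-map {E = joint edges x y} {F = protocolGraph (alice P x) (bob P y)} encode hom (run x y)))
    where
    hom : ∀ σ u → mate (protocolGraph (alice P x) (bob P y) σ) (encode u)
                ≡ Maybe.map encode (mate (joint edges x y σ) u)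
    hom 𝐀 u = cong (λ v → Maybe.map encode (mate (edges 𝐀 x) v)) (strictlyInverseˡ u)
    hom 𝐁 u = trans (pipes-dropTap (transport fin (edges 𝐁 y)) (cong (Maybe.map encode) (free y)) (encode u))
                    (cong (λ v → Maybe.map encode (mate (edges 𝐁 y) v)) (strictlyInverseˡ u))

point-first : ∀ {m} {V : Set} → Fin (suc m) ↔ V → (t : V) →
              Σ (Fin (suc m) ↔ V) λ fin → Inverse.to fin zero ≡ t
point-first fin t = fin ↔-∘ Perm.transpose zero (Inverse.from fin t) , trans (cong (λ i → Inverse.to fin i) first) (Inverse.strictlyInverseˡ fin t)
  where
  first : PC.transpose zero (Inverse.from fin t) zero ≡ Inverse.from fin t
  first = refl

module _ {n : ℕ} where

  private
    stub : Box n ⊤ ⊥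
    stub = record
      { size = 1 ; Vertex = ⊤ ; finite = Finₚ.1↔⊤ ; edges = λ _ _ → emptyPairing
      ; port = ↔⇒↪ (mk↔ₛ′ (λ _ → tt) inj₁ (λ _ → refl) (λ { (inj₁ _) → refl ; (inj₂ ()) }))
      ; port-free = λ _ _ → refl }

    false-↪ : ⊤ ↪ Bool
    false-↪ = point-↪ Boolₚ._≟_ false

  -- The path is odd when it ends in a port.  A stub at the output false adds
  -- one more edge.
  box⇒HasGH : (b : Box n ⊤ Bool) (h : Fn n) → (∀ x y → Leads b x y tt (h x y)) → HasGH h (size b)
  box⇒HasGH b h leads = protocol-from-graph fin (edges b′) tap-free h run
    where
    only-false : Box n ⊤ ⊤
    only-false = relabel ↪-id false-↪ b

    b′ : Box n ⊤ ⊥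
    b′ = only-false ⨾ stub

    tap : Vertex b′
    tap = to (port b′) (inj₁ tt)

    -- The stub compensates for the tap, which is no pipe: `size b + 1` vertices make a protocol of
    -- size `size b`.
    tap-first : Σ (Fin (suc (size b)) ↔ Vertex b′) λ fin → Inverse.to fin zero ≡ tap
    tap-first = point-first (subst (λ m → Fin m ↔ Vertex b′) (ℕₚ.+-comm (size b) 1) (finite b′)) tap

    fin = proj₁ tap-first

    tap-free : ∀ y → mate (edges b′ 𝐁 y) (Inverse.to fin zero) ≡ nothing
    tap-free y = trans (cong (mate (edges b′ 𝐁 y)) (proj₂ tap-first)) (port-free b′ y (inj₁ tt))

    run-to : ∀ x y r → Leads b x y tt r → Run (graph b′ x y) 𝐀 tap r
    run-to x y true p = run-odd (graph b′ x y) (⨾-pathˡ only-false stub {x} {y} (relabel-path ↪-id false-↪ b p))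
      (stop (⨾-dead only-false stub {x} {y} (port-free b y (inj₂ true)) unused))
      where
      unused : from (port only-false ↪-∘ inj₂-↪) (to (port b) (inj₂ true)) ≡ nothing
      unused rewrite from-to (port b) (inj₂ true) = refl
    run-to x y false p = run-odd (graph b′ x y) (⨾-pathˡ only-false stub {x} {y} (relabel-path ↪-id false-↪ b p))
      (step (⨾-edge only-false stub {x} {y} tt) (stop refl))

    run : ∀ x y → Run (graph b′ x y) 𝐀 (Inverse.to fin zero) (h x y)
    run x y = subst (λ t → Run (graph b′ x y) 𝐀 t (h x y)) (sym (proj₂ tap-first))
      (run-to x y (h x y) (leads x y))

-- Reversible programs over the values f i

bit : Bool → ℕ
bit true  = 1
bit false = 0

countTrue-suc : ∀ k (z : Fin (suc k) → Bool) → countTrue (suc k) z ≡ bit (z zero) + countTrue k (z ∘ suc)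
countTrue-suc k z with z zero
... | true  = refl
... | false = refl

iterate : ∀ {A : Set} → (A → A) → ℕ → A → A
iterate f zero    a = a
iterate f (suc m) a = iterate f m (f a)

iterate-+ : ∀ {A : Set} (f : A → A) p q a → iterate f (p + q) a ≡ iterate f q (iterate f p a)
iterate-+ f zero    q a = refl
iterate-+ f (suc p) q a = iterate-+ f p q (f a)

-- Without pipes the tap has no possible neighbour, so the path has length 0. Protocols of size 0
-- can therefore be skipped, which keeps the additive overhead of a gate within a constant multiple
-- of the size.
empty-protocol-false : ∀ {n} {h : Fn n} → HasGH h 0 → ∀ x y → h x y ≡ false
empty-protocol-false (P , computes) x y with partner (alice P x) zero in e | computes x y
... | nothing   | c = sym c
... | just zero | _ = ⊥-elim (irrefl (alice P x) zero e)

-- Applying `π` or not according to the bit is injective as long as the bit is kept, so it amounts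
-- to a renaming of ports.
shear-↪ : ∀ {A : Set} → A ↪ A → A × Bool ↪ A × Bool
shear-↪ {A} π = record
  { to = λ { (a , false) → a , false ; (a , true) → to π a , true }
  ; from = λ { (a , false) → just (a , false) ; (a , true) → Maybe.map (_, true) (from π a) }
  ; from-to = λ { (a , false) → refl ; (a , true) → cong (Maybe.map (_, true)) (from-to π a) }
  ; to-from = λ { {b = _ , false} refl → refl ; {b = a , true} e → back a e } }
  where
  back : ∀ a {p} → Maybe.map (_, true) (from π a) ≡ just p → _ ≡ (a , true)
  back a e with _ , e′ , refl ← map-just⁻¹ (from π a) e = cong (_, true) (to-from π e′)

module _ {n a : ℕ} {A : Set} (fin : Fin a ↔ A) (π : A ↪ A) where

  private
    ask unask : Box n ⊤ Bool → Box n _ _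
    ask g = relabel ×⊤-↪ ↪-id (copies fin g)
    unask g = relabel (shear-↪ π) ×⊤-↪ (rev (copies fin g))

  -- The answer of g is forgotten by asking g once more, backwards.
  controlled : Box n ⊤ Bool → Box n A A
  controlled g = ask g ⨾ unask g

  controlled-leads : (g : Box n ⊤ Bool) {x y : Vec Bool n} {v : Bool} → Leads g x y tt v →
                     ∀ i → Leads (controlled g) x y i (if v then to π i else i)
  controlled-leads g {x} {y} {v} p i = ⨾-leads (ask g) (unask g)
    (relabel-leads ×⊤-↪ ↪-id (copies fin g) {x} {y} {i} {i , v} (copies-leads fin g i p))
    (relabel-leads (shear-↪ π) ×⊤-↪ (rev (copies fin g)) {x} {y} {i , v} (back v p))
    where
    back : ∀ v → Leads g x y tt v →
           Leads (rev (copies fin g)) x y (to (shear-↪ π) (i , v)) ((if v then to π i else i) , tt)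
    back false p = rev-leads (copies fin g) (copies-leads fin g i p)
    back true  p = rev-leads (copies fin g) (copies-leads fin g (to π i) p)

  private
    prepend : ∀ {h m} → HasGH h m → Box n A A → Box n A A
    prepend {m = zero}  _       b = b
    prepend {m = suc _} (P , _) b = controlled (gate P) ⨾ b

    prepend-leads : ∀ {h m} (g : HasGH h m) (b : Box n A A) {x y i o} →
                    Leads b x y (iterate (to π) (bit (h x y)) i) o → Leads (prepend g b) x y i o
    prepend-leads {m = zero} g b {x} {y} p rewrite empty-protocol-false g x y = p
    prepend-leads {h} {suc _} (P , computes) b {x} {y} {i} p = ⨾-leads (controlled (gate P)) b
      (turned (subst (λ v → Leads (gate P) x y tt v) (computes x y) (gate-leads P x y))) p
      where
      turned : ∀ {v} → Leads (gate P) x y tt v →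
               Leads (controlled (gate P)) x y i (iterate (to π) (bit v) i)
      turned {false} q = controlled-leads (gate P) q i
      turned {true}  q = controlled-leads (gate P) q i

    prepend-size : ∀ {h m} (g : HasGH h m) (b : Box n A A) → size (prepend g b) ≤ a * (12 * m) + size b
    prepend-size {m = zero} g b = ℕₚ.m≤n+m (size b) (a * 0)
    prepend-size {m = suc m} g b = ℕₚ.+-monoˡ-≤ (size b) (begin
      a * (3 * (2 + m)) + a * (3 * (2 + m)) ≡⟨ ℕₚ.*-distribˡ-+ a (3 * (2 + m)) _ ⟨
      a * (3 * (2 + m) + 3 * (2 + m))       ≤⟨ ℕₚ.*-monoʳ-≤ a (twice m) ⟩
      a * (12 * suc m)                      ∎)
      where
      open ℕₚ.≤-Reasoning
      twice : ∀ m → 3 * (2 + m) + 3 * (2 + m) ≤ 12 * suc m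
      twice m = subst (3 * (2 + m) + 3 * (2 + m) ≤_) (slack m) (ℕₚ.m≤m+n _ (6 * m))
        where
        slack : ∀ m → 3 * (2 + m) + 3 * (2 + m) + 6 * m ≡ 12 * suc m
        slack = ℕ-solve

  sweep : ∀ k (f : Fin k → Fn n) (s : Fin k → ℕ) → (∀ i → HasGH (f i) (s i)) → Box n A A
  sweep zero    f s gs = wire fin
  sweep (suc k) f s gs = prepend (gs zero) (sweep k (f ∘ suc) (s ∘ suc) (gs ∘ suc))

  sweep-leads : ∀ k f s gs {x y} i →
                Leads (sweep k f s gs) x y i (iterate (to π) (countTrue k (λ j → f j x y)) i)
  sweep-leads zero    f s gs i = wire-leads fin i
  sweep-leads (suc k) f s gs {x} {y} i
    rewrite countTrue-suc k (λ j → f j x y) | iterate-+ (to π) (bit (f zero x y)) (countTrue k (λ j → f (suc j) x y)) i =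
    prepend-leads (gs zero) (sweep k (f ∘ suc) (s ∘ suc) (gs ∘ suc))
      (sweep-leads k (f ∘ suc) (s ∘ suc) (gs ∘ suc) _)

  sweep-size : ∀ k f s gs → size (sweep k f s gs) ≤ a * (2 + 12 * sumFin k s)
  sweep-size zero f s gs = ℕₚ.≤-reflexive (double a)
    where
    double : ∀ a → a + a ≡ a * 2
    double = ℕ-solve
  sweep-size (suc k) f s gs = begin
    size (sweep (suc k) f s gs)           ≤⟨ prepend-size (gs zero) rest ⟩
    a * (12 * s zero) + size rest         ≤⟨ ℕₚ.+-monoʳ-≤ _ (sweep-size k (f ∘ suc) (s ∘ suc) (gs ∘ suc)) ⟩
    a * (12 * s zero) + a * (2 + 12 * sumFin k (s ∘ suc)) ≡⟨ regroup a (s zero) (sumFin k (s ∘ suc)) ⟩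
    a * (2 + 12 * sumFin (suc k) s)       ∎
    where
    open ℕₚ.≤-Reasoning
    rest = sweep k (f ∘ suc) (s ∘ suc) (gs ∘ suc)
    regroup : ∀ a t r → a * (12 * t) + a * (2 + 12 * r) ≡ a * (2 + 12 * (t + r))
    regroup = ℕ-solve

-- Disjunction, conjunction, parity

-- `Q` is a promise on the inputs. Several exits may share a verdict: they are merged only once, by
-- `decider⇒GH≤`, instead of after every step.
record Decider {n} (Q : Vec Bool n → Vec Bool n → Set) (h : Fn n) (m : ℕ) : Set₁ where
  field
    Exit    : Set
    verdict : Exit → Bool
    box     : Box n ⊤ Exit
    small   : size box ≤ m
    correct : ∀ x y → Q x y → ∃[ o ] Leads box x y tt o × verdict o ≡ h x y

open Decider public

always : ∀ {n} → Vec Bool n → Vec Bool n → Set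
always _ _ = ⊤

module _ {n : ℕ} where

  -- The factor 3 consists of the box itself and a reversed copy for each of the two verdicts.
  decider⇒GH≤ : ∀ {h : Fn n} {m} → Decider always h m → GH≤ h (3 * m)
  decider⇒GH≤ {h} {m} d = size decided , ℕₚ.*-monoʳ-≤ 3 (small d) , box⇒HasGH decided h leads
    where
    decided : Box n ⊤ Bool
    decided = classify Finₚ.2↔Bool Boolₚ._≟_ (verdict d) (box d)
    leads : ∀ x y → Leads decided x y tt (h x y)
    leads x y with o , p , e ← correct d x y tt =
      subst (Leads decided x y tt) e (classify-leads Finₚ.2↔Bool Boolₚ._≟_ (verdict d) (box d) p)

  decider-cong : ∀ {Q} {h h′ : Fn n} {m m′} → m ≤ m′ → (∀ x y → h x y ≡ h′ x y) →
                 Decider Q h m → Decider Q h′ m′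
  decider-cong m≤m′ h≡h′ d = record
    { Exit = Exit d ; verdict = verdict d ; box = box d ; small = ℕₚ.≤-trans (small d) m≤m′
    ; correct = λ x y q → let o , p , e = correct d x y q in o , p , trans e (h≡h′ x y) }

  constant : ∀ {Q} c → Decider {n} Q (λ _ _ → c) 2
  constant c = record
    { Exit = ⊤ ; verdict = λ _ → c ; box = wire Finₚ.1↔⊤ ; small = ℕₚ.≤-refl
    ; correct = λ x y _ → tt , wire-leads Finₚ.1↔⊤ tt , refl }

  -- `inj₁` hands the path on to a decider for `h`, whose promise `Q` must hold by then; `inj₂ v`
  -- has settled the answer and bypasses that decider along a wire.
  Sound : ∀ {X : Set} → (X → Bool) → (Vec Bool n → Vec Bool n → Set) → Fn n → Fn n →
          Vec Bool n → Vec Bool n → ⊤ ⊎ X → Set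
  Sound val Q h h′ x y (inj₁ _) = Q x y × h x y ≡ h′ x y
  Sound val Q h h′ x y (inj₂ v) = val v ≡ h′ x y

  module _ {e : ℕ} {X : Set} (fin : Fin e ↔ X) (val : X → Bool) {Q Q′ : Vec Bool n → Vec Bool n → Set}
           {h h′ : Fn n} {m : ℕ} (b : Box n ⊤ (⊤ ⊎ X)) (d : Decider Q h m) where

    continue-with : (∀ x y → Q′ x y → ∃[ r ] Leads b x y tt r × Sound val Q h h′ x y r) →
                    Decider Q′ h′ (size b + (m + (e + e)))
    continue-with next = record
      { Exit = Exit d ⊎ X ; verdict = Sum.[ verdict d , val ]
      ; box = b ⨾ (box d ∥ wire fin)
      ; small = ℕₚ.+-monoʳ-≤ (size b) (ℕₚ.+-monoˡ-≤ (e + e) (small d))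
      ; correct = λ x y q → proceed x y (next x y q) }
      where
      proceed : ∀ x y → ∃[ r ] Leads b x y tt r × Sound val Q h h′ x y r →
                ∃[ o ] Leads (b ⨾ (box d ∥ wire fin)) x y tt o × Sum.[ verdict d , val ] o ≡ h′ x y
      proceed x y (inj₁ _ , p , q , h≡) with o , p′ , v≡ ← correct d x y q =
        inj₁ o , ⨾-leads b (box d ∥ wire fin) {o = inj₁ o} p (∥-leadsˡ (box d) (wire fin) {i = tt} {o} p′) , trans v≡ h≡
      proceed x y (inj₂ v , p , v≡) =
        inj₂ v , ⨾-leads b (box d ∥ wire fin) {o = inj₂ v} p (∥-leadsʳ (box d) (wire fin) {i = v} {v} (wire-leads fin v)) , v≡

-- `c` is the absorbing element, `true` for `_∨_` and `false` for `_∧_`: the chain is left at the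
-- first value `c`.
module Fold {n : ℕ} (_·_ : Bool → Bool → Bool) (c : Bool)
            (absorb : ∀ v → c · v ≡ c) (neutral : ∀ v → not c · v ≡ v) where

  private
    answer : Bool → ⊤ ⊎ ⊤ → Bool
    answer d (inj₁ _) = not d
    answer d (inj₂ _) = d

    answer↔ : ∀ d → (⊤ ⊎ ⊤) ↔ Bool
    answer↔ d = mk↔ₛ′ (answer d) (back d) (to-back d) (back-to d)
      where
      back : Bool → Bool → ⊤ ⊎ ⊤
      back d v = if d xor v then inj₁ tt else inj₂ tt
      to-back : ∀ d v → answer d (back d v) ≡ v
      to-back false false = refl
      to-back false true  = refl
      to-back true  false = refl
      to-back true  true  = refl
      back-to : ∀ d r → back d (answer d r) ≡ r
      back-to false (inj₁ _) = refl
      back-to false (inj₂ _) = refl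
      back-to true  (inj₁ _) = refl
      back-to true  (inj₂ _) = refl

    -- A protocol of size 0 leaves no room for a gate, but then `g` is constantly `false`: this
    -- value is either neutral, so that `g` is dropped, or absorbing, so that the result is
    -- constant. The hypothesis `2 ≤ m` pays for the wire of the constant.
    combine : ∀ {g h : Fn n} t {m} → HasGH g t → 2 ≤ m → Decider always h m →
              Decider always (λ x y → g x y · h x y) (8 * t + m)
    combine {g} {h} zero γ 2≤m d with c Boolₚ.≟ true
    ... | yes c≡true = decider-cong ℕₚ.≤-refl (λ x y → sym (begin
      g x y · h x y  ≡⟨ cong (_· h x y) (trans (empty-protocol-false γ x y) (sym (cong not c≡true))) ⟩
      not c · h x y  ≡⟨ neutral (h x y) ⟩
      h x y          ∎)) d
      where open ≡-Reasoning
    ... | no c≢true = decider-cong 2≤m (λ x y → sym (begin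
      g x y · h x y  ≡⟨ cong (_· h x y) (trans (empty-protocol-false γ x y) (sym (Boolₚ.¬-not c≢true))) ⟩
      c · h x y      ≡⟨ absorb (h x y) ⟩
      c              ∎)) (constant c)
      where open ≡-Reasoning
    combine {g} {h} (suc t) {m} (P , computes) 2≤m d = decider-cong bound (λ _ _ → refl)
      (continue-with Finₚ.1↔⊤ (λ _ → c) ask d λ x y _ →
        Inverse.from (answer↔ c) (g x y) ,
        relabel-leads ↪-id (↔⇒↪ (answer↔ c)) (gate P) {i = tt} {Inverse.from (answer↔ c) (g x y)}
          (subst (Leads (gate P) x y tt) (trans (computes x y) (sym (Inverse.strictlyInverseˡ (answer↔ c) (g x y)))) (gate-leads P x y)) ,
        sound x y (Inverse.from (answer↔ c) (g x y)) (Inverse.strictlyInverseˡ (answer↔ c) (g x y)))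
      where
      ask : Box n ⊤ (⊤ ⊎ ⊤)
      ask = relabel ↪-id (↔⇒↪ (answer↔ c)) (gate P)
      sound : ∀ x y r → answer c r ≡ g x y → Sound (λ _ → c) always h (λ x y → g x y · h x y) x y r
      sound x y (inj₁ _) e = tt , sym (trans (cong (_· h x y) (sym e)) (neutral (h x y)))
      sound x y (inj₂ _) e = sym (trans (cong (_· h x y) (sym e)) (absorb (h x y)))
      bound : 3 * suc (suc t) + (m + 2) ≤ 8 * suc t + m
      bound = subst (3 * suc (suc t) + (m + 2) ≤_) (slack t m) (ℕₚ.m≤m+n _ (5 * t))
        where
        slack : ∀ t m → 3 * suc (suc t) + (m + 2) + 5 * t ≡ 8 * suc t + m
        slack = ℕ-solve

  chain : ∀ k (f : Fin k → Fn n) (s : Fin k → ℕ) → (∀ i → HasGH (f i) (s i)) →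
          Decider always (λ x y → foldFin _·_ (not c) k (λ i → f i x y)) (8 * sumFin k s + 2)
  chain zero    f s gs = constant (not c)
  chain (suc k) f s gs = decider-cong (ℕₚ.≤-reflexive (regroup (s zero) (sumFin k (s ∘ suc)))) (λ _ _ → refl)
    (combine (s zero) (gs zero) (ℕₚ.m≤n+m 2 (8 * sumFin k (s ∘ suc))) (chain k (f ∘ suc) (s ∘ suc) (gs ∘ suc)))
    where
    regroup : ∀ t r → 8 * t + (8 * r + 2) ≡ 8 * (t + r) + 2
    regroup = ℕ-solve

sumFin-zero : ∀ k (s : Fin k → ℕ) → sumFin k s ≡ 0 → ∀ i → s i ≡ 0
sumFin-zero (suc k) s e zero    = ℕₚ.m+n≡0⇒m≡0 (s zero) e
sumFin-zero (suc k) s e (suc i) = sumFin-zero k (s ∘ suc) (ℕₚ.m+n≡0⇒n≡0 (s zero) e) i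

foldFin-false : ∀ (_·_ : Bool → Bool → Bool) → false · false ≡ false →
                ∀ k z → (∀ i → z i ≡ false) → foldFin _·_ false k z ≡ false
foldFin-false _·_ e zero    z z≡ = refl
foldFin-false _·_ e (suc k) z z≡ rewrite z≡ zero | foldFin-false _·_ e k (z ∘ suc) (z≡ ∘ suc) = e

countTrue-false : ∀ k z → (∀ i → z i ≡ false) → countTrue k z ≡ 0
countTrue-false zero    z z≡ = refl
countTrue-false (suc k) z z≡ rewrite countTrue-suc k z | z≡ zero = countTrue-false k (z ∘ suc) (z≡ ∘ suc)

xor-iterate : ∀ k z a → iterate not (countTrue k z) a ≡ a xor foldFin _xor_ false k z
xor-iterate zero    z a = sym (Boolₚ.xor-identityʳ a)
xor-iterate (suc k) z a rewrite countTrue-suc k z with z zero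
... | false = xor-iterate k (z ∘ suc) a
... | true  = trans (xor-iterate k (z ∘ suc) (not a)) (xor-step a _)

module _ {n k : ℕ} (1≤k : 1 ≤ k) (f : Fin k → Fn n) (s : Fin k → ℕ) (gs : ∀ i → HasGH (f i) (s i)) where

  -- If no pipe is available at all then every f i is constantly false, and
  -- there is no room for any overhead.
  nonempty-GH≤ : ∀ {h : Fn n} {m} → (∀ x y → (∀ i → f i x y ≡ false) → h x y ≡ false) →
                 (1 ≤ sumFin k s → GH≤ h m) → GH≤ h m
  nonempty-GH≤ {h} {m} h-false g with sumFin k s in e
  ... | suc _ = g (s≤s z≤n)
  ... | zero  = 0 , z≤n , empty
    where
    all-false : ∀ i x y → f i x y ≡ false
    all-false i = empty-protocol-false (subst (HasGH (f i)) (sumFin-zero k s e i) (gs i))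
    first : Fin k
    first = fromℕ< 1≤k
    empty : HasGH h 0
    empty with P , computes ← subst (HasGH (f first)) (sumFin-zero k s e first) (gs first) =
      P , λ x y → trans (computes x y) (trans (all-false first x y) (sym (h-false x y (λ i → all-false i x y))))

  private
    chain-bound : ∀ {h : Fn n} → 1 ≤ sumFin k s → Decider always h (8 * sumFin k s + 2) → GH≤ h (30 * sumFin k s)
    chain-bound 1≤Σ d with t , t≤ , γ ← decider⇒GH≤ d = t , ℕₚ.≤-trans t≤ bound , γ
      where
      open ℕₚ.≤-Reasoning
      Σs = sumFin k s
      collect : ∀ r → 3 * (8 * r + 2 * r) ≡ 30 * r
      collect = ℕ-solve
      bound : 3 * (8 * Σs + 2) ≤ 30 * Σs
      bound = begin
        3 * (8 * Σs + 2)      ≤⟨ ℕₚ.*-monoʳ-≤ 3 (ℕₚ.+-monoʳ-≤ (8 * Σs) (ℕₚ.*-monoʳ-≤ 2 1≤Σ)) ⟩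
        3 * (8 * Σs + 2 * Σs) ≡⟨ collect Σs ⟩
        30 * Σs               ∎

  GH-OR : GH≤ (ORf k f) (30 * sumFin k s)
  GH-OR = nonempty-GH≤ (λ x y → foldFin-false _∨_ refl k _)
    λ 1≤Σ → chain-bound 1≤Σ (Fold.chain _∨_ true (λ _ → refl) (λ _ → refl) k f s gs)

  GH-AND : GH≤ (ANDf k f) (30 * sumFin k s)
  GH-AND = nonempty-GH≤ (λ x y → and-false 1≤k)
    λ 1≤Σ → chain-bound 1≤Σ (Fold.chain _∧_ false (λ _ → refl) (λ _ → refl) k f s gs)
    where
    and-false : ∀ {k} {z : Fin k → Bool} → 1 ≤ k → (∀ i → z i ≡ false) → foldFin _∧_ true k z ≡ false
    and-false {suc k} _ z≡ rewrite z≡ zero = refl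

  GH-XOR : GH≤ (XORf k f) (84 * sumFin k s)
  GH-XOR = nonempty-GH≤ (λ x y → foldFin-false _xor_ refl k _)
    λ 1≤Σ → let t , t≤ , γ = decider⇒GH≤ parity in t , ℕₚ.≤-trans t≤ (bound 1≤Σ) , γ
    where
    not-↪ : Bool ↪ Bool
    not-↪ = ↔⇒↪ (mk↔ₛ′ not not Boolₚ.not-involutive Boolₚ.not-involutive)

    body : Box n Bool Bool
    body = sweep Finₚ.2↔Bool not-↪ k f s gs

    parity : Decider always (XORf k f) (2 * (2 + 12 * sumFin k s))
    parity = record
      { Exit = Bool ; verdict = id ; box = relabel (point-↪ Boolₚ._≟_ false) ↪-id body
      ; small = sweep-size Finₚ.2↔Bool not-↪ k f s gs
      ; correct = λ x y _ → _ , relabel-leads (point-↪ Boolₚ._≟_ false) ↪-id body {o = iterate not (countTrue k (λ i → f i x y)) false}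
                                  (sweep-leads Finₚ.2↔Bool not-↪ k f s gs false)
                              , xor-iterate k (λ i → f i x y) false }

    bound : 1 ≤ sumFin k s → 3 * (2 * (2 + 12 * sumFin k s)) ≤ 84 * sumFin k s
    bound 1≤Σ = begin
      3 * (2 * (2 + 12 * Σs))      ≤⟨ ℕₚ.*-monoʳ-≤ 3 (ℕₚ.*-monoʳ-≤ 2 (ℕₚ.+-monoˡ-≤ (12 * Σs) (ℕₚ.*-monoʳ-≤ 2 1≤Σ))) ⟩
      3 * (2 * (2 * Σs + 12 * Σs)) ≡⟨ collect Σs ⟩
      84 * Σs                      ∎
      where
      open ℕₚ.≤-Reasoning
      Σs = sumFin k s
      collect : ∀ r → 3 * (2 * (2 * r + 12 * r)) ≡ 84 * r
      collect = ℕ-solve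

-- Residues

-- The network stores only `s`; the proof follows an integer `z` in its residue class, for which the
-- rounding errors can be estimated.
Residue : ∀ {P} → Fin P → ℤ → Set
Residue {P} s z = ∃[ q ] z ≡ + toℕ s ℤ.+ q ℤ.* + P

module _ {P : ℕ} where

  private
    no-overlap : ∀ {s t : Fin P} {z} ((q , _) : Residue s z) ((r , _) : Residue t z) → ¬ q ℤ.< r
    no-overlap {s} {t} {z} (q , z≡) (r , z≡′) q<r = ℤₚ.<-irrefl refl (begin-strict
      z                                    ≡⟨ z≡ ⟩
      + toℕ s ℤ.+ q ℤ.* + P                <⟨ ℤₚ.+-monoˡ-< (q ℤ.* + P) (ℤ.+<+ (Finₚ.toℕ<n s)) ⟩
      + P ℤ.+ q ℤ.* + P                    ≡⟨ ℤₚ.suc-* q (+ P) ⟨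
      ℤ.suc q ℤ.* + P                      ≤⟨ ℤₚ.*-monoʳ-≤-nonNeg (+ P) (ℤₚ.i<j⇒suc[i]≤j q<r) ⟩
      r ℤ.* + P                            ≤⟨ ℤₚ.i≤j+i (r ℤ.* + P) (+ toℕ t) ⟩
      + toℕ t ℤ.+ r ℤ.* + P                ≡⟨ z≡′ ⟨
      z                                    ∎)
      where open ℤₚ.≤-Reasoning

  residue-unique : ∀ {s t : Fin P} {z} → Residue s z → Residue t z → s ≡ t
  residue-unique {s} {t} ρ@(q , z≡) ρ′@(r , z≡′) with ℤₚ.<-cmp q r
  ... | tri< q<r _ _ = ⊥-elim (no-overlap {s} {t} ρ ρ′ q<r)
  ... | tri> _ _ r<q = ⊥-elim (no-overlap {t} {s} ρ′ ρ r<q)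
  ... | tri≈ _ refl _ = Finₚ.toℕ-injective (ℤₚ.+-injective (∙-cancelʳ ℤₚ.+-0-abelianGroup (q ℤ.* + P) _ _ (trans (sym z≡) z≡′)))

module _ (P : ℕ) .{{_ : NonZero P}} where

  residue : ℤ → Fin P
  residue z = fromℕ< (ℤᵈ.n%ℕd<d z P)

  residue-correct : ∀ z → Residue (residue z) z
  residue-correct z = z ℤᵈ./ℕ P , trans (ℤᵈ.a≡a%ℕn+[a/ℕn]*n z P)
    (cong (λ r → + r ℤ.+ (z ℤᵈ./ℕ P) ℤ.* + P) (sym (Finₚ.toℕ-fromℕ< (ℤᵈ.n%ℕd<d z P))))

  rotate : ℤ → Fin P → Fin P
  rotate c s = residue (+ toℕ s ℤ.+ c)

  rotate-residue : ∀ c {s z} → Residue s z → Residue (rotate c s) (z ℤ.+ c)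
  rotate-residue c {s} {z} (q , z≡) with r , e ← residue-correct (+ toℕ s ℤ.+ c) = q ℤ.+ r , (begin
    z ℤ.+ c                                          ≡⟨ cong (ℤ._+ c) z≡ ⟩
    + toℕ s ℤ.+ q ℤ.* + P ℤ.+ c                      ≡⟨ shuffle (+ toℕ s) q (+ P) c ⟩
    + toℕ s ℤ.+ c ℤ.+ q ℤ.* + P                      ≡⟨ cong (ℤ._+ q ℤ.* + P) e ⟩
    + toℕ (rotate c s) ℤ.+ r ℤ.* + P ℤ.+ q ℤ.* + P   ≡⟨ collect (+ toℕ (rotate c s)) q r (+ P) ⟩
    + toℕ (rotate c s) ℤ.+ (q ℤ.+ r) ℤ.* + P         ∎)
    where
    open ≡-Reasoning
    shuffle : ∀ a q p c → a ℤ.+ q ℤ.* p ℤ.+ c ≡ a ℤ.+ c ℤ.+ q ℤ.* p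
    shuffle = ℤ-solve
    collect : ∀ a q r p → a ℤ.+ r ℤ.* p ℤ.+ q ℤ.* p ≡ a ℤ.+ (q ℤ.+ r) ℤ.* p
    collect = ℤ-solve

  rotation : ℤ → Fin P ↪ Fin P
  rotation c = ↔⇒↪ (mk↔ₛ′ (rotate c) (rotate (ℤ.- c)) (inverse (ℤ.- c) c cancel₁) (inverse c (ℤ.- c) cancel₂))
    where
    cancel₁ : ∀ z → z ℤ.+ ℤ.- c ℤ.+ c ≡ z
    cancel₁ z = trans (ℤₚ.+-assoc z (ℤ.- c) c) (trans (cong (λ w → z ℤ.+ w) (ℤₚ.+-inverseˡ c)) (ℤₚ.+-identityʳ z))
    cancel₂ : ∀ z → z ℤ.+ c ℤ.+ ℤ.- c ≡ z
    cancel₂ z = trans (ℤₚ.+-assoc z c (ℤ.- c)) (trans (cong (λ w → z ℤ.+ w) (ℤₚ.+-inverseʳ c)) (ℤₚ.+-identityʳ z))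
    itself : ∀ s → Residue s (+ toℕ s)
    itself s = + 0 , sym (ℤₚ.+-identityʳ (+ toℕ s))
    inverse : ∀ c d → (∀ z → z ℤ.+ c ℤ.+ d ≡ z) → ∀ s → rotate d (rotate c s) ≡ s
    inverse c d cancel s = residue-unique
      (subst (Residue (rotate d (rotate c s))) (cancel (+ toℕ s)) (rotate-residue d {rotate c s} (rotate-residue c {s} (itself s))))
      (itself s)

  iterate-residue : ∀ c m {s z} → Residue s z → Residue (iterate (rotate c) m s) (z ℤ.+ + m ℤ.* c)
  iterate-residue c zero    {s} {z} ρ = subst (Residue s) (sym (ℤₚ.+-identityʳ z)) ρ
  iterate-residue c (suc m) {s} {z} ρ = subst (Residue (iterate (rotate c) (suc m) s)) (regroup (+ m) z c)
    (iterate-residue c m {rotate c s} (rotate-residue c {s} ρ))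
    where
    regroup : ∀ m z c → z ℤ.+ c ℤ.+ m ℤ.* c ≡ z ℤ.+ (+ 1 ℤ.+ m) ℤ.* c
    regroup = ℤ-solve

module _ (K p : ℕ) .{{_ : NonZero p}} where

  private
    stretchℕ : ℕ → ℕ
    stretchℕ s = s + s / p

    stretchℕ-mono-< : ∀ {s t} → s < t → stretchℕ s < stretchℕ t
    stretchℕ-mono-< s<t = ℕₚ.+-mono-<-≤ s<t (ℕᵈ./-monoˡ-≤ p (ℕₚ.<⇒≤ s<t))

    stretchℕ-< : ∀ {s} → s < K * p → stretchℕ s < K * suc p
    stretchℕ-< {s} s<Kp = subst (stretchℕ s <_) (trans (ℕₚ.+-comm (K * p) K) (sym (ℕₚ.*-suc K p)))
      (ℕₚ.+-mono-<-≤ s<Kp (ℕₚ.<⇒≤ (ℕᵈ.m<n*o⇒m/o<n s<Kp)))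

  -- Rounds the phase s / (K p) down to a multiple of 1 / (K (p + 1)).
  stretch : Fin (K * p) → Fin (K * suc p)
  stretch s = fromℕ< (stretchℕ-< (Finₚ.toℕ<n s))

  stretch-injective : ∀ {s t} → stretch s ≡ stretch t → s ≡ t
  stretch-injective {s} {t} e with ℕₚ.<-cmp (toℕ s) (toℕ t)
  ... | tri≈ _ s≡t _ = Finₚ.toℕ-injective s≡t
  ... | tri< s<t _ _ = ⊥-elim (ℕₚ.<-irrefl (Finₚ.fromℕ<-injective _ _ _ _ e) (stretchℕ-mono-< s<t))
  ... | tri> _ _ t<s = ⊥-elim (ℕₚ.<-irrefl (Finₚ.fromℕ<-injective _ _ _ _ (sym e)) (stretchℕ-mono-< t<s))

  -- Here w = ⌊z (p + 1) / p⌋. Shifting z by a multiple of K p shifts w by the same multiple of K (p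
  -- + 1), so the rounding is compatible with residues. The loss z / (K p) - w / (K (p + 1)) equals
  -- r / (K p (p + 1)), which is below 1 / (K (p + 1)).
  stretch-residue : ∀ {s z} → Residue s z →
    ∃[ w ] Residue (stretch s) w × ∃[ r ] r < p × w ℤ.* + p ℤ.+ + r ≡ z ℤ.* + suc p
  stretch-residue {s} {z} (q , z≡) =
      + toℕ (stretch s) ℤ.+ q ℤ.* + (K * suc p) , (q , refl) , toℕ s % p , ℕᵈ.m%n<n (toℕ s) p , (begin
    (+ toℕ (stretch s) ℤ.+ q ℤ.* + (K * suc p)) ℤ.* + p ℤ.+ + r
      ≡⟨ cong₂ (λ a b → (a ℤ.+ q ℤ.* b) ℤ.* + p ℤ.+ + r) (cong +_ (Finₚ.toℕ-fromℕ< _)) (ℤₚ.pos-* K (suc p)) ⟩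
    (+ toℕ s ℤ.+ + d ℤ.+ q ℤ.* (+ K ℤ.* (+ 1 ℤ.+ + p))) ℤ.* + p ℤ.+ + r
      ≡⟨ cong (λ a → (a ℤ.+ + d ℤ.+ q ℤ.* (+ K ℤ.* (+ 1 ℤ.+ + p))) ℤ.* + p ℤ.+ + r) s≡ ⟩
    (+ r ℤ.+ + d ℤ.* + p ℤ.+ + d ℤ.+ q ℤ.* (+ K ℤ.* (+ 1 ℤ.+ + p))) ℤ.* + p ℤ.+ + r
      ≡⟨ calc (+ r) (+ d) (+ p) (+ K) q ⟩
    (+ r ℤ.+ + d ℤ.* + p ℤ.+ q ℤ.* (+ K ℤ.* + p)) ℤ.* (+ 1 ℤ.+ + p)
      ≡⟨ cong₂ (λ a b → (a ℤ.+ q ℤ.* b) ℤ.* + suc p) (sym s≡) (sym (ℤₚ.pos-* K p)) ⟩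
    (+ toℕ s ℤ.+ q ℤ.* + (K * p)) ℤ.* + suc p
      ≡⟨ cong (ℤ._* + suc p) z≡ ⟨
    z ℤ.* + suc p ∎)
    where
    open ≡-Reasoning
    r = toℕ s % p
    d = toℕ s / p
    s≡ : + toℕ s ≡ + r ℤ.+ + d ℤ.* + p
    s≡ = trans (cong +_ (ℕᵈ.m≡m%n+[m/n]*n (toℕ s) p)) (cong (λ w → + r ℤ.+ w) (ℤₚ.pos-* d p))
    calc : ∀ r d p K q → (r ℤ.+ d ℤ.* p ℤ.+ d ℤ.+ q ℤ.* (K ℤ.* (+ 1 ℤ.+ p))) ℤ.* p ℤ.+ r
                       ≡ (r ℤ.+ d ℤ.* p ℤ.+ q ℤ.* (K ℤ.* p)) ℤ.* (+ 1 ℤ.+ p)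
    calc = ℤ-solve

-- Phases with varying denominators

-- Inequalities between integers are proved in the form 0 ≤ e, so that the
-- ring solver does the bookkeeping.
0≤+ : ∀ {i j} → + 0 ℤ.≤ i → + 0 ℤ.≤ j → + 0 ℤ.≤ i ℤ.+ j
0≤+ 0≤i 0≤j = ℤₚ.+-mono-≤ 0≤i 0≤j

0≤* : ∀ {i j} → + 0 ℤ.≤ i → + 0 ℤ.≤ j → + 0 ℤ.≤ i ℤ.* j
0≤* {+ m} {+ n} _ _ = subst (+ 0 ℤ.≤_) (ℤₚ.pos-* m n) (ℤ.+≤+ z≤n)

0≤pos : ∀ m → + 0 ℤ.≤ + m
0≤pos m = ℤ.+≤+ z≤n

0≤-cancel : ∀ {i} m → + 0 ℤ.≤ + suc m ℤ.* i → + 0 ℤ.≤ i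
0≤-cancel {i} m 0≤mi = ℤₚ.*-cancelˡ-≤-pos (+ 0) i (+ suc m) (subst (ℤ._≤ + suc m ℤ.* i) (sym (ℤₚ.*-zeroʳ (+ suc m))) 0≤mi)

-- The coefficient (-1)^j C(a,j), by Pascal's rule.
coef : ℕ → ℕ → ℤ
coef zero    zero    = + 1
coef zero    (suc j) = + 0
coef (suc a) zero    = coef a zero
coef (suc a) (suc j) = coef a (suc j) ℤ.- coef a j

coef-vanishes : ∀ a j → a < j → coef a j ≡ + 0
coef-vanishes zero    (suc j) _         = refl
coef-vanishes (suc a) (suc j) (s≤s a<j)
  rewrite coef-vanishes a (suc j) (ℕₚ.m≤n⇒m≤1+n a<j) | coef-vanishes a j a<j = refl

-- Σ_{j ≤ n} (-1)^j C(a,j) γ(i + j); for n = a this is the a-th iterated difference.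
difference : (ℕ → ℤ) → ℕ → ℕ → ℕ → ℤ
difference γ a zero    i = coef a zero ℤ.* γ i
difference γ a (suc n) i = difference γ a n i ℤ.+ coef a (suc n) ℤ.* γ (suc n + i)

-- Pascal's rule, summed. The upper limit `n` is kept apart from `a` so that the induction can run
-- over `n` alone.
difference-suc : ∀ γ a n i → difference γ (suc a) (suc n) i ≡ difference γ a (suc n) i ℤ.- difference γ a n (suc i)
difference-suc γ a zero i = calc (coef a 0) (coef a 1) (γ i) (γ (suc i))
  where
  calc : ∀ c d u v → c ℤ.* u ℤ.+ (d ℤ.- c) ℤ.* v ≡ c ℤ.* u ℤ.+ d ℤ.* v ℤ.- c ℤ.* v
  calc = ℤ-solve
difference-suc γ a (suc n) i rewrite difference-suc γ a n i | ℕₚ.+-suc n i =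
  calc (difference γ a (suc n) i) (difference γ a n (suc i)) (coef a (suc n)) (coef a (suc (suc n))) (γ (suc (suc (n + i))))
  where
  calc : ∀ S T c d u → S ℤ.- T ℤ.+ (d ℤ.- c) ℤ.* u ≡ S ℤ.+ d ℤ.* u ℤ.- (T ℤ.+ c ℤ.* u)
  calc = ℤ-solve

-- The product (i + 1)(i + 2)...(i + a + 1).
rising : ℕ → ℕ → ℕ
rising zero    i = suc i
rising (suc a) i = rising a i * suc (suc a + i)

rising-shift : ∀ a i → rising (suc a) i ≡ suc i * rising a (suc i)
rising-shift zero    i = refl
rising-shift (suc a) i = begin
  rising (suc a) i * suc (suc (suc a) + i)            ≡⟨ cong₂ _*_ (rising-shift a i) (cong suc (sym (ℕₚ.+-suc (suc a) i))) ⟩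
  suc i * rising a (suc i) * suc (suc a + suc i)      ≡⟨ ℕₚ.*-assoc (suc i) (rising a (suc i)) _ ⟩
  suc i * rising (suc a) (suc i)                      ∎
  where open ≡-Reasoning

-- By induction on a: the a-th differences at i and i + 1 have the common denominator
-- `rising (suc a) i`, and the numerators combine to a! ((i + a + 2) - (i + 1)) = (a + 1)!. Scaling
-- by `G` avoids fractions.
difference-reciprocal : ∀ (γ : ℕ → ℤ) G a i → (∀ j → j ≤ a → γ (j + i) ℤ.* + suc (j + i) ≡ G) →
                        difference γ a a i ℤ.* + rising a i ≡ + (a !) ℤ.* G
difference-reciprocal γ G zero i γ≡ = begin
  + 1 ℤ.* γ i ℤ.* + suc i   ≡⟨ cong (ℤ._* + suc i) (ℤₚ.*-identityˡ (γ i)) ⟩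
  γ i ℤ.* + suc i           ≡⟨ γ≡ 0 z≤n ⟩
  G                         ≡⟨ ℤₚ.*-identityˡ G ⟨
  + 1 ℤ.* G                 ∎
  where open ≡-Reasoning
difference-reciprocal γ G (suc a) i γ≡ = begin
  difference γ (suc a) (suc a) i ℤ.* R₁
    ≡⟨ cong (ℤ._* R₁) (trans (difference-suc γ a a i) (cong (ℤ._- V) U≡)) ⟩
  (U ℤ.- V) ℤ.* R₁
    ≡⟨ distrib U V R₁ ⟩
  U ℤ.* R₁ ℤ.- V ℤ.* R₁
    ≡⟨ cong₂ (λ x y → U ℤ.* x ℤ.- V ℤ.* y) (ℤₚ.pos-* (rising a i) (suc (suc a + i)))
         (trans (cong +_ (rising-shift a i)) (ℤₚ.pos-* (suc i) (rising a (suc i)))) ⟩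
  U ℤ.* (R ℤ.* + suc (suc a + i)) ℤ.- V ℤ.* (+ suc i ℤ.* R′)
    ≡⟨ regroup U V R R′ (+ suc (suc a + i)) (+ suc i) ⟩
  U ℤ.* R ℤ.* + suc (suc a + i) ℤ.- V ℤ.* R′ ℤ.* + suc i
    ≡⟨ cong₂ (λ x y → x ℤ.* + suc (suc a + i) ℤ.- y ℤ.* + suc i)
         (difference-reciprocal γ G a i (λ j j≤a → γ≡ j (ℕₚ.m≤n⇒m≤1+n j≤a)))
         (difference-reciprocal γ G a (suc i) (λ j j≤a → subst (λ k → γ k ℤ.* + suc k ≡ G) (sym (ℕₚ.+-suc j i)) (γ≡ (suc j) (s≤s j≤a)))) ⟩
  + (a !) ℤ.* G ℤ.* + suc (suc a + i) ℤ.- + (a !) ℤ.* G ℤ.* + suc i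
    ≡⟨ cong (λ k → + (a !) ℤ.* G ℤ.* + k ℤ.- + (a !) ℤ.* G ℤ.* + suc i) (sym (ℕₚ.+-suc (suc a) i)) ⟩
  + (a !) ℤ.* G ℤ.* (+ suc a ℤ.+ + suc i) ℤ.- + (a !) ℤ.* G ℤ.* + suc i
    ≡⟨ factor (+ (a !)) G (+ suc a) (+ suc i) ⟩
  + suc a ℤ.* + (a !) ℤ.* G
    ≡⟨ cong (ℤ._* G) (ℤₚ.pos-* (suc a) (a !)) ⟨
  + (suc a !) ℤ.* G ∎
  where
  open ≡-Reasoning
  U = difference γ a a i
  V = difference γ a a (suc i)
  R₁ = + rising (suc a) i
  R = + rising a i
  R′ = + rising a (suc i)
  U≡ : difference γ a (suc a) i ≡ U
  U≡ rewrite coef-vanishes a (suc a) ℕₚ.≤-refl = ℤₚ.+-identityʳ U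
  distrib : ∀ u v r → (u ℤ.- v) ℤ.* r ≡ u ℤ.* r ℤ.- v ℤ.* r
  distrib = ℤ-solve
  regroup : ∀ u v r r′ x y → u ℤ.* (r ℤ.* x) ℤ.- v ℤ.* (y ℤ.* r′) ≡ u ℤ.* r ℤ.* x ℤ.- v ℤ.* r′ ℤ.* y
  regroup = ℤ-solve
  factor : ∀ f g x y → f ℤ.* g ℤ.* (x ℤ.+ y) ℤ.- f ℤ.* g ℤ.* y ≡ x ℤ.* f ℤ.* g
  factor = ℤ-solve

-- γ j = G / (j + 1) makes phases with different denominators comparable.
-- K D difference γ m j m is the intended value after the moduli K (m + 1), …, K (m + 1 + j).
module Phase (K m g : ℕ) (D : ℤ) (γ : ℕ → ℤ) (γ-nonneg : ∀ j → + 0 ℤ.≤ γ j)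
             (γ-reciprocal : ∀ j → j ≤ m → γ (j + m) ℤ.* + suc (j + m) ≡ + suc g) where

  private
    G = + suc g
    T : ℕ → ℤ
    T j = difference γ m j m

  -- In units of 1 / (G K), rounding from the modulus K p to K (p + 1) loses at most γ p of phase.
  loss : ℕ → ℤ
  loss zero    = + 0
  loss (suc j) = loss j ℤ.+ γ (suc j + m)

  -- Divided by G K this is the intended phase minus the actual phase z / (K (j + m + 1)).
  lag : ℕ → ℤ → ℤ
  lag j z = + K ℤ.* D ℤ.* T j ℤ.- γ (j + m) ℤ.* z

  Approximates : ℕ → ℤ → Set
  Approximates j z = + 0 ℤ.≤ lag j z × + 0 ℤ.≤ loss j ℤ.- lag j z

  approximates-start : Approximates 0 (+ K ℤ.* coef m 0 ℤ.* D)
  approximates-start = nonneg , subst (λ e → + 0 ℤ.≤ + 0 ℤ.- e) (sym lag≡0) ℤₚ.≤-refl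
    where
    lag≡0 : lag 0 (+ K ℤ.* coef m 0 ℤ.* D) ≡ + 0
    lag≡0 = calc (+ K) D (coef m 0) (γ m)
      where
      calc : ∀ K D c u → K ℤ.* D ℤ.* (c ℤ.* u) ℤ.- u ℤ.* (K ℤ.* c ℤ.* D) ≡ + 0
      calc = ℤ-solve
    nonneg : + 0 ℤ.≤ lag 0 (+ K ℤ.* coef m 0 ℤ.* D)
    nonneg = subst (+ 0 ℤ.≤_) (sym lag≡0) ℤₚ.≤-refl

  -- Adding the next multiple of D moves the intended and the actual phase equally, so the lag grows
  -- only by the rounding loss `δ`; by `pδ≡` it is v r / p, hence 0 ≤ δ ≤ v.
  approximates-step : ∀ {j z w r} → suc j ≤ m → Approximates j z → r < suc (j + m) →
    w ℤ.* + suc (j + m) ℤ.+ + r ≡ z ℤ.* + suc (suc (j + m)) →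
    Approximates (suc j) (w ℤ.+ + K ℤ.* coef m (suc j) ℤ.* D)
  approximates-step {j} {z} {w} {r} j<m (low , high) r<p w≡ =
      subst (+ 0 ℤ.≤_) (sym lag≡) (0≤+ low 0≤δ)
    , subst (+ 0 ℤ.≤_) loss≡ (0≤+ high 0≤v-δ)
    where
    open ≡-Reasoning
    p = suc (j + m)
    u = γ (j + m)
    v = γ (suc j + m)
    δ = u ℤ.* z ℤ.- v ℤ.* w
    lag≡ : lag (suc j) (w ℤ.+ + K ℤ.* coef m (suc j) ℤ.* D) ≡ lag j z ℤ.+ δ
    lag≡ = calc (+ K) D (T j) (coef m (suc j)) u v z w
      where
      calc : ∀ K D T c u v z w → K ℤ.* D ℤ.* (T ℤ.+ c ℤ.* v) ℤ.- v ℤ.* (w ℤ.+ K ℤ.* c ℤ.* D)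
                                ≡ K ℤ.* D ℤ.* T ℤ.- u ℤ.* z ℤ.+ (u ℤ.* z ℤ.- v ℤ.* w)
      calc = ℤ-solve
    loss≡ : loss j ℤ.- lag j z ℤ.+ (v ℤ.- δ) ≡ loss (suc j) ℤ.- lag (suc j) (w ℤ.+ + K ℤ.* coef m (suc j) ℤ.* D)
    loss≡ rewrite lag≡ = calc (loss j) (lag j z) v δ
      where
      calc : ∀ a b v d → a ℤ.- b ℤ.+ (v ℤ.- d) ≡ a ℤ.+ v ℤ.- (b ℤ.+ d)
      calc = ℤ-solve
    pδ≡ : + p ℤ.* δ ≡ v ℤ.* + r
    pδ≡ = begin
      + p ℤ.* (u ℤ.* z ℤ.- v ℤ.* w)
        ≡⟨ calc₁ (+ p) (+ r) u v z w ⟩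
      u ℤ.* + p ℤ.* z ℤ.- v ℤ.* (w ℤ.* + p ℤ.+ + r) ℤ.+ v ℤ.* + r
        ≡⟨ cong₂ (λ a b → a ℤ.* z ℤ.- v ℤ.* b ℤ.+ v ℤ.* + r) (γ-reciprocal j (ℕₚ.<⇒≤ j<m)) w≡ ⟩
      G ℤ.* z ℤ.- v ℤ.* (z ℤ.* + suc p) ℤ.+ v ℤ.* + r
        ≡⟨ cong (λ a → a ℤ.* z ℤ.- v ℤ.* (z ℤ.* + suc p) ℤ.+ v ℤ.* + r) (γ-reciprocal (suc j) j<m) ⟨
      v ℤ.* + suc p ℤ.* z ℤ.- v ℤ.* (z ℤ.* + suc p) ℤ.+ v ℤ.* + r
        ≡⟨ calc₂ v (+ suc p) z (+ r) ⟩
      v ℤ.* + r ∎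
      where
      calc₁ : ∀ p r u v z w → p ℤ.* (u ℤ.* z ℤ.- v ℤ.* w) ≡ u ℤ.* p ℤ.* z ℤ.- v ℤ.* (w ℤ.* p ℤ.+ r) ℤ.+ v ℤ.* r
      calc₁ = ℤ-solve
      calc₂ : ∀ v q z r → v ℤ.* q ℤ.* z ℤ.- v ℤ.* (z ℤ.* q) ℤ.+ v ℤ.* r ≡ v ℤ.* r
      calc₂ = ℤ-solve
    0≤δ : + 0 ℤ.≤ δ
    0≤δ = 0≤-cancel (j + m) (subst (+ 0 ℤ.≤_) (sym pδ≡) (0≤* (γ-nonneg _) (0≤pos r)))
    0≤v-δ : + 0 ℤ.≤ v ℤ.- δ
    0≤v-δ = 0≤-cancel (j + m) (subst (+ 0 ℤ.≤_) eq
      (0≤* (γ-nonneg _) (ℤₚ.i≤j⇒0≤j-i (ℤ.+≤+ (ℕₚ.<⇒≤ r<p)))))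
      where
      eq : v ℤ.* (+ p ℤ.- + r) ≡ + p ℤ.* (v ℤ.- δ)
      eq = begin
        v ℤ.* (+ p ℤ.- + r)          ≡⟨ calc₁ v (+ p) (+ r) ⟩
        + p ℤ.* v ℤ.- v ℤ.* + r      ≡⟨ cong (λ a → + p ℤ.* v ℤ.- a) pδ≡ ⟨
        + p ℤ.* v ℤ.- + p ℤ.* δ      ≡⟨ calc₂ (+ p) v δ ⟩
        + p ℤ.* (v ℤ.- δ)            ∎
        where
        calc₁ : ∀ v p r → v ℤ.* (p ℤ.- r) ≡ p ℤ.* v ℤ.- v ℤ.* r
        calc₁ = ℤ-solve
        calc₂ : ∀ p v d → p ℤ.* v ℤ.- p ℤ.* d ≡ p ℤ.* (v ℤ.- d)
        calc₂ = ℤ-solve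

  private
    -- Each summand of `loss` is at most G / (m + 1), as all denominators exceed m + 1. The m
    -- summands together stay within G, which is a phase of 1 / K.
    loss-bound : ∀ j → j ≤ m → + 0 ℤ.≤ + j ℤ.* G ℤ.- loss j ℤ.* + suc m
    loss-bound zero    _   = ℤₚ.≤-refl
    loss-bound (suc j) j<m = subst (+ 0 ℤ.≤_) eq
      (0≤+ (loss-bound j (ℕₚ.<⇒≤ j<m)) (0≤* (γ-nonneg (suc j + m)) (0≤pos (suc j))))
      where
      open ≡-Reasoning
      v = γ (suc j + m)
      eq : + j ℤ.* G ℤ.- loss j ℤ.* + suc m ℤ.+ v ℤ.* + suc j ≡ + suc j ℤ.* G ℤ.- (loss j ℤ.+ v) ℤ.* + suc m
      eq = begin
        + j ℤ.* G ℤ.- loss j ℤ.* + suc m ℤ.+ v ℤ.* + suc j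
          ≡⟨ calc (+ j) (loss j) (+ m) v G ⟩
        + suc j ℤ.* G ℤ.- (loss j ℤ.+ v) ℤ.* + suc m ℤ.+ (v ℤ.* (+ suc (suc j + m)) ℤ.- G)
          ≡⟨ cong (λ a → + suc j ℤ.* G ℤ.- (loss j ℤ.+ v) ℤ.* + suc m ℤ.+ (a ℤ.- G)) (γ-reciprocal (suc j) j<m) ⟩
        + suc j ℤ.* G ℤ.- (loss j ℤ.+ v) ℤ.* + suc m ℤ.+ (G ℤ.- G)
          ≡⟨ drop (+ suc j ℤ.* G ℤ.- (loss j ℤ.+ v) ℤ.* + suc m) G ⟩
        + suc j ℤ.* G ℤ.- (loss j ℤ.+ v) ℤ.* + suc m ∎
        where
        calc : ∀ j l m v G → j ℤ.* G ℤ.- l ℤ.* (+ 1 ℤ.+ m) ℤ.+ v ℤ.* (+ 1 ℤ.+ j)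
             ≡ (+ 1 ℤ.+ j) ℤ.* G ℤ.- (l ℤ.+ v) ℤ.* (+ 1 ℤ.+ m) ℤ.+ (v ℤ.* (+ 1 ℤ.+ (+ 1 ℤ.+ j ℤ.+ m)) ℤ.- G)
        calc = ℤ-solve
        drop : ∀ x g → x ℤ.+ (g ℤ.- g) ≡ x
        drop = ℤ-solve

    loss≤G : + 0 ℤ.≤ G ℤ.- loss m
    loss≤G = 0≤-cancel m (subst (+ 0 ℤ.≤_) (calc (+ m) G (loss m)) (0≤+ (loss-bound m ℕₚ.≤-refl) (0≤pos (suc g))))
      where
      calc : ∀ m G l → m ℤ.* G ℤ.- l ℤ.* (+ 1 ℤ.+ m) ℤ.+ G ≡ (+ 1 ℤ.+ m) ℤ.* (G ℤ.- l)
      calc = ℤ-solve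

  -- Divided by R K p this reads 0 ≤ D m! / R − z / (K p) ≤ 1 / K, where R / m! = (m + 1) C(2m + 1, m).
  approximation : ∀ {z} → Approximates m z →
    let p = + suc (m + m); R = + rising m m; e = + K ℤ.* p ℤ.* D ℤ.* + (m !) ℤ.- z ℤ.* R in
    + 0 ℤ.≤ e × + 0 ℤ.≤ R ℤ.* p ℤ.- e
  approximation {z} (low , high) =
      0≤-cancel g (subst (+ 0 ℤ.≤_) low≡ (0≤* low (0≤* (0≤pos (rising m m)) (0≤pos (suc (m + m))))))
    , 0≤-cancel g (subst (+ 0 ℤ.≤_) high≡
        (0≤* (0≤+ high loss≤G) (0≤* (0≤pos (rising m m)) (0≤pos (suc (m + m))))))
    where
    open ≡-Reasoning
    p = + suc (m + m)
    R = + rising m m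
    F = + (m !)
    u = γ (m + m)
    e = + K ℤ.* p ℤ.* D ℤ.* F ℤ.- z ℤ.* R
    low≡ : lag m z ℤ.* (R ℤ.* p) ≡ G ℤ.* e
    low≡ = begin
      (+ K ℤ.* D ℤ.* T m ℤ.- u ℤ.* z) ℤ.* (R ℤ.* p)
        ≡⟨ calc₁ (+ K) D (T m) u z R p ⟩
      + K ℤ.* D ℤ.* (T m ℤ.* R) ℤ.* p ℤ.- u ℤ.* p ℤ.* z ℤ.* R
        ≡⟨ cong₂ (λ a b → + K ℤ.* D ℤ.* a ℤ.* p ℤ.- b ℤ.* z ℤ.* R)
             (difference-reciprocal γ G m m γ-reciprocal) (γ-reciprocal m ℕₚ.≤-refl) ⟩
      + K ℤ.* D ℤ.* (F ℤ.* G) ℤ.* p ℤ.- G ℤ.* z ℤ.* R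
        ≡⟨ calc₂ (+ K) D F G p z R ⟩
      G ℤ.* e ∎
      where
      calc₁ : ∀ K D T u z R p → (K ℤ.* D ℤ.* T ℤ.- u ℤ.* z) ℤ.* (R ℤ.* p) ≡ K ℤ.* D ℤ.* (T ℤ.* R) ℤ.* p ℤ.- u ℤ.* p ℤ.* z ℤ.* R
      calc₁ = ℤ-solve
      calc₂ : ∀ K D F G p z R → K ℤ.* D ℤ.* (F ℤ.* G) ℤ.* p ℤ.- G ℤ.* z ℤ.* R ≡ G ℤ.* (K ℤ.* p ℤ.* D ℤ.* F ℤ.- z ℤ.* R)
      calc₂ = ℤ-solve
    high≡ : (loss m ℤ.- lag m z ℤ.+ (G ℤ.- loss m)) ℤ.* (R ℤ.* p) ≡ G ℤ.* (R ℤ.* p ℤ.- e)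
    high≡ = begin
      (loss m ℤ.- lag m z ℤ.+ (G ℤ.- loss m)) ℤ.* (R ℤ.* p)  ≡⟨ calc₁ (loss m) (lag m z) G (R ℤ.* p) ⟩
      G ℤ.* (R ℤ.* p) ℤ.- lag m z ℤ.* (R ℤ.* p)              ≡⟨ cong (λ a → G ℤ.* (R ℤ.* p) ℤ.- a) low≡ ⟩
      G ℤ.* (R ℤ.* p) ℤ.- G ℤ.* e                            ≡⟨ calc₂ G (R ℤ.* p) e ⟩
      G ℤ.* (R ℤ.* p ℤ.- e)                                  ∎
      where
      calc₁ : ∀ l a G r → (l ℤ.- a ℤ.+ (G ℤ.- l)) ℤ.* r ≡ G ℤ.* r ℤ.- a ℤ.* r
      calc₁ = ℤ-solve
      calc₂ : ∀ G r e → G ℤ.* r ℤ.- G ℤ.* e ≡ G ℤ.* (r ℤ.- e)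
      calc₂ = ℤ-solve

-- Reading off a phase

-- A phase t / 48 ≤ s / P < (t + 1) / 48 is close to 0 or 1, or in (0, 1/2), or in [1/2, 1).
judge : ℕ → ⊤ ⊎ Bool
judge t with t ℕₚ.<? 1 | t ℕₚ.<? 24 | t ℕₚ.<? 47
... | yes _ | _     | _     = inj₁ tt
... | no _  | yes _ | _     = inj₂ true
... | no _  | no _  | yes _ = inj₂ false
... | no _  | no _  | no _  = inj₁ tt

-- Used with a = D m! and R = `rising m m`, so that a / R = D / N; `inj₁` then means |D| ≤ N / 24.
Judged : (R a : ℤ) → ⊤ ⊎ Bool → Set
Judged R a (inj₁ _)     = + 0 ℤ.≤ R ℤ.- + 24 ℤ.* a × + 0 ℤ.≤ R ℤ.+ + 24 ℤ.* a
Judged R a (inj₂ true)  = + 0 ℤ.< a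
Judged R a (inj₂ false) = a ℤ.< + 0

module _ (r : ℕ) (a q : ℤ) (t : ℕ) (t<48 : t < 48) where

  private
    R = + suc r
    N = + t ℤ.+ q ℤ.* + 48
    -- X / (48 R) is the excess of a / R over `N` / 48, the phase read off together with its integer
    -- part. It is below 2 / 48: at most 1 / 48 stems from the rounding during the scan, and less
    -- than 1 / 48 from reducing the state to `t`.
    X = + 48 ℤ.* a ℤ.- R ℤ.* N

    module _ (0≤X : + 0 ℤ.≤ X) (X<2R : + 0 ℤ.< R ℤ.+ R ℤ.- X)
             (upper : + 0 ℤ.≤ R ℤ.- + 4 ℤ.* a) (lower : + 0 ℤ.≤ R ℤ.+ + 4 ℤ.* a) where

      N≤12 : + 0 ℤ.≤ + 12 ℤ.- N
      N≤12 = 0≤-cancel r (subst (+ 0 ℤ.≤_) (calc R a N) (0≤+ (0≤* (0≤pos 12) upper) 0≤X))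
        where
        calc : ∀ R a N → + 12 ℤ.* (R ℤ.- + 4 ℤ.* a) ℤ.+ (+ 48 ℤ.* a ℤ.- R ℤ.* N) ≡ R ℤ.* (+ 12 ℤ.- N)
        calc = ℤ-solve

      -14≤N : + 0 ℤ.≤ N ℤ.+ + 14
      -14≤N = 0≤-cancel r (subst (+ 0 ℤ.≤_) (calc R a N) (0≤+ (0≤* (0≤pos 12) lower) (ℤₚ.<⇒≤ X<2R)))
        where
        calc : ∀ R a N → + 12 ℤ.* (R ℤ.+ + 4 ℤ.* a) ℤ.+ (R ℤ.+ R ℤ.- (+ 48 ℤ.* a ℤ.- R ℤ.* N)) ≡ R ℤ.* (N ℤ.+ + 14)
        calc = ℤ-solve

      -- The bounds -14 ≤ N ≤ 12 leave only the integer parts q = 0 and q = -1, the latter with t ≥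
      -- 48 - 14; so the sign of `a` shows in `t`.
      wraps : (q ≡ + 0 × t ≤ 12) ⊎ (q ≡ -[1+ 0 ] × 34 ≤ t)
      wraps = by-q q refl
        where
        by-q : ∀ q′ → q ≡ q′ → (q ≡ + 0 × t ≤ 12) ⊎ (q ≡ -[1+ 0 ] × 34 ≤ t)
        by-q (+ 0) refl = inj₁ (refl , ℤₚ.drop‿+≤+ (ℤₚ.0≤i-j⇒j≤i (subst (+ 0 ℤ.≤_) (calc (+ t)) N≤12)))
          where
          calc : ∀ t → + 12 ℤ.- (t ℤ.+ + 0 ℤ.* + 48) ≡ + 12 ℤ.- t
          calc = ℤ-solve
        by-q -[1+ 0 ] refl = inj₂ (refl , ℤₚ.drop‿+≤+ (ℤₚ.0≤i-j⇒j≤i (subst (+ 0 ℤ.≤_) (calc (+ t)) -14≤N)))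
          where
          calc : ∀ t → t ℤ.+ (ℤ.- + 1) ℤ.* + 48 ℤ.+ + 14 ≡ t ℤ.- + 34
          calc = ℤ-solve
        by-q (+ suc n) refl = ⊥-elim (absurd (subst (+ 0 ℤ.≤_) (calc (+ t) (+ n))
          (0≤+ N≤12 (0≤+ (0≤pos t) (0≤* (0≤pos n) (0≤pos 48))))))
          where
          absurd : ¬ + 0 ℤ.≤ ℤ.- + 36
          absurd ()
          calc : ∀ t n → + 12 ℤ.- (t ℤ.+ (+ 1 ℤ.+ n) ℤ.* + 48) ℤ.+ (t ℤ.+ n ℤ.* + 48) ≡ ℤ.- + 36
          calc = ℤ-solve
        by-q -[1+ suc n ] refl = ⊥-elim (absurd (subst (+ 0 ℤ.≤_) (calc (+ t) (+ n))
          (0≤+ (0≤+ -14≤N (ℤₚ.i≤j⇒0≤j-i (ℤ.+≤+ (ℕₚ.≤-pred t<48)))) (0≤* (0≤pos n) (0≤pos 48)))))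
          where
          absurd : ¬ + 0 ℤ.≤ ℤ.- + 35
          absurd ()
          calc : ∀ t n → t ℤ.+ (ℤ.- (+ 2 ℤ.+ n)) ℤ.* + 48 ℤ.+ + 14 ℤ.+ (+ 47 ℤ.- t) ℤ.+ n ℤ.* + 48 ≡ ℤ.- + 35
          calc = ℤ-solve

      halve : ∀ {i j} → + 2 ℤ.* i ≡ j → + 0 ℤ.≤ j → + 0 ℤ.≤ i
      halve refl = 0≤-cancel 1

      judged-near-0 : q ≡ + 0 → t < 1 → + 0 ℤ.≤ R ℤ.- + 24 ℤ.* a × + 0 ℤ.≤ R ℤ.+ + 24 ℤ.* a
      judged-near-0 refl (s≤s z≤n) = halve (calc₁ R a) (ℤₚ.<⇒≤ X<2R) , halve (calc₂ R a) (0≤+ (0≤+ 0≤X (0≤pos (suc r))) (0≤pos (suc r)))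
        where
        calc₁ : ∀ R a → + 2 ℤ.* (R ℤ.- + 24 ℤ.* a) ≡ R ℤ.+ R ℤ.- (+ 48 ℤ.* a ℤ.- R ℤ.* (+ 0 ℤ.+ + 0 ℤ.* + 48))
        calc₁ = ℤ-solve
        calc₂ : ∀ R a → + 2 ℤ.* (R ℤ.+ + 24 ℤ.* a) ≡ + 48 ℤ.* a ℤ.- R ℤ.* (+ 0 ℤ.+ + 0 ℤ.* + 48) ℤ.+ R ℤ.+ R
        calc₂ = ℤ-solve

      judged-near-1 : q ≡ -[1+ 0 ] → t ≡ 47 → + 0 ℤ.≤ R ℤ.- + 24 ℤ.* a × + 0 ℤ.≤ R ℤ.+ + 24 ℤ.* a
      judged-near-1 refl refl = halve (calc₁ R a) (0≤+ (ℤₚ.<⇒≤ X<2R) (0≤pos (suc r))) , halve (calc₂ R a) (0≤+ 0≤X (0≤pos (suc r)))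
        where
        calc₁ : ∀ R a → + 2 ℤ.* (R ℤ.- + 24 ℤ.* a) ≡ R ℤ.+ R ℤ.- (+ 48 ℤ.* a ℤ.- R ℤ.* (+ 47 ℤ.+ (ℤ.- + 1) ℤ.* + 48)) ℤ.+ R
        calc₁ = ℤ-solve
        calc₂ : ∀ R a → + 2 ℤ.* (R ℤ.+ + 24 ℤ.* a) ≡ + 48 ℤ.* a ℤ.- R ℤ.* (+ 47 ℤ.+ (ℤ.- + 1) ℤ.* + 48) ℤ.+ R
        calc₂ = ℤ-solve

      judged-positive : q ≡ + 0 → 1 ≤ t → + 0 ℤ.< a
      judged-positive refl 1≤t = ℤₚ.*-cancelˡ-<-nonNeg (+ 48) (ℤₚ.<-≤-trans (ℤ.+<+ (s≤s z≤n)) R≤48a)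
        where
        R≤48a : R ℤ.≤ + 48 ℤ.* a
        R≤48a = ℤₚ.0≤i-j⇒j≤i (subst (+ 0 ℤ.≤_) (calc R a (+ t)) (0≤+ 0≤X (0≤* (0≤pos (suc r)) (ℤₚ.i≤j⇒0≤j-i (ℤ.+≤+ 1≤t)))))
          where
          calc : ∀ R a t → + 48 ℤ.* a ℤ.- R ℤ.* (t ℤ.+ + 0 ℤ.* + 48) ℤ.+ R ℤ.* (t ℤ.- + 1) ≡ + 48 ℤ.* a ℤ.- R
          calc = ℤ-solve

      -- `t ≤ 46` means N ≤ -2, which an error below two units cannot make up for. At t = 47 it
      -- could, so `judge` counts that value as close to 1.
      judged-negative : q ≡ -[1+ 0 ] → t ≤ 46 → a ℤ.< + 0
      judged-negative refl t≤46 = ℤₚ.*-cancelˡ-<-nonNeg (+ 48) (ℤₚ.≤-<-trans 48a≤ (ℤₚ.neg-mono-< X<2R))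
        where
        48a≤ : + 48 ℤ.* a ℤ.≤ ℤ.- (R ℤ.+ R ℤ.- X)
        48a≤ = ℤₚ.0≤i-j⇒j≤i (subst (+ 0 ℤ.≤_) (calc R a (+ t)) (0≤* (0≤pos (suc r)) (ℤₚ.i≤j⇒0≤j-i (ℤ.+≤+ t≤46))))
          where
          calc : ∀ R a t → R ℤ.* (+ 46 ℤ.- t) ≡ ℤ.- (R ℤ.+ R ℤ.- (+ 48 ℤ.* a ℤ.- R ℤ.* (t ℤ.+ (ℤ.- + 1) ℤ.* + 48))) ℤ.- + 48 ℤ.* a
          calc = ℤ-solve

  judge-correct : + 0 ℤ.≤ X → + 0 ℤ.< R ℤ.+ R ℤ.- X → + 0 ℤ.≤ R ℤ.- + 4 ℤ.* a → + 0 ℤ.≤ R ℤ.+ + 4 ℤ.* a →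
                  Judged R a (judge t)
  judge-correct 0≤X X<2R upper lower
    with t ℕₚ.<? 1 | t ℕₚ.<? 24 | t ℕₚ.<? 47 | wraps 0≤X X<2R upper lower
  ... | yes t<1 | _        | _        | inj₁ (q≡ , _)    = judged-near-0 0≤X X<2R upper lower q≡ t<1
  ... | yes t<1 | _        | _        | inj₂ (_ , 34≤t)  = ⊥-elim (ℕₚ.<⇒≱ t<1 (ℕₚ.≤-trans (s≤s z≤n) 34≤t))
  ... | no t≮1  | yes _    | _        | inj₁ (q≡ , _)    = judged-positive 0≤X X<2R upper lower q≡ (ℕₚ.≮⇒≥ t≮1)
  ... | no _    | yes t<24 | _        | inj₂ (_ , 34≤t)  = ⊥-elim (ℕₚ.<⇒≱ t<24 (ℕₚ.≤-trans (ℕₚ.m≤m+n 24 10) 34≤t))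
  ... | no _    | no t≮24  | _        | inj₁ (_ , t≤12)  = ⊥-elim (t≮24 (ℕₚ.≤-trans (s≤s t≤12) (ℕₚ.m≤m+n 13 11)))
  ... | no _    | no _     | yes t<47 | inj₂ (q≡ , _)    = judged-negative 0≤X X<2R upper lower q≡ (ℕₚ.≤-pred t<47)
  ... | no _    | no _     | no t≮47  | inj₂ (q≡ , _)    =
    judged-near-1 0≤X X<2R upper lower q≡ (ℕₚ.≤-antisym (ℕₚ.≤-pred t<48) (ℕₚ.≮⇒≥ t≮47))

judge-state : ∀ p′ r (D F z : ℤ) (s : Fin (48 * suc p′)) → Residue s z →
  let p = + suc p′; R = + suc r; e = + 48 ℤ.* p ℤ.* D ℤ.* F ℤ.- z ℤ.* R in
  + 0 ℤ.≤ e → + 0 ℤ.≤ R ℤ.* p ℤ.- e →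
  + 0 ℤ.≤ R ℤ.- + 4 ℤ.* (D ℤ.* F) → + 0 ℤ.≤ R ℤ.+ + 4 ℤ.* (D ℤ.* F) →
  Judged R (D ℤ.* F) (judge (toℕ s / suc p′))
judge-state p′ r D F z s (q , z≡) low high = judge-correct r (D ℤ.* F) q t
    (ℕᵈ.m<n*o⇒m/o<n (Finₚ.toℕ<n s))
    (0≤-cancel p′ (subst (+ 0 ℤ.≤_) (sym pX≡) (0≤+ low (0≤* (0≤pos (suc r)) (0≤pos ρ)))))
    (ℤₚ.*-cancelˡ-<-nonNeg p (subst₂ ℤ._<_ (sym (ℤₚ.*-zeroʳ p)) (sym p[2R-X]≡) positive))
  where
  open ≡-Reasoning
  p = + suc p′
  R = + suc r
  e = + 48 ℤ.* p ℤ.* D ℤ.* F ℤ.- z ℤ.* R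
  t = toℕ s / suc p′
  ρ = toℕ s % suc p′
  X = + 48 ℤ.* (D ℤ.* F) ℤ.- R ℤ.* (+ t ℤ.+ q ℤ.* + 48)
  z≡′ : z ≡ + ρ ℤ.+ + t ℤ.* p ℤ.+ q ℤ.* (+ 48 ℤ.* p)
  z≡′ = trans z≡ (cong₂ (λ a b → a ℤ.+ q ℤ.* b)
    (trans (cong +_ (ℕᵈ.m≡m%n+[m/n]*n (toℕ s) (suc p′))) (cong (λ a → + ρ ℤ.+ a) (ℤₚ.pos-* t (suc p′))))
    (ℤₚ.pos-* 48 (suc p′)))
  pX≡ : p ℤ.* X ≡ e ℤ.+ R ℤ.* + ρ
  pX≡ = trans (calc p D F R (+ t) q (+ ρ)) (cong (λ y → + 48 ℤ.* p ℤ.* D ℤ.* F ℤ.- y ℤ.* R ℤ.+ R ℤ.* + ρ) (sym z≡′))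
    where
    calc : ∀ p D F R t q ρ → p ℤ.* (+ 48 ℤ.* (D ℤ.* F) ℤ.- R ℤ.* (t ℤ.+ q ℤ.* + 48))
         ≡ + 48 ℤ.* p ℤ.* D ℤ.* F ℤ.- (ρ ℤ.+ t ℤ.* p ℤ.+ q ℤ.* (+ 48 ℤ.* p)) ℤ.* R ℤ.+ R ℤ.* ρ
    calc = ℤ-solve
  p[2R-X]≡ : p ℤ.* (R ℤ.+ R ℤ.- X) ≡ R ℤ.* p ℤ.- e ℤ.+ R ℤ.* (p ℤ.- + ρ)
  p[2R-X]≡ = begin
    p ℤ.* (R ℤ.+ R ℤ.- X)                      ≡⟨ calc₁ p R X ⟩
    R ℤ.* p ℤ.+ R ℤ.* p ℤ.- p ℤ.* X            ≡⟨ cong (λ y → R ℤ.* p ℤ.+ R ℤ.* p ℤ.- y) pX≡ ⟩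
    R ℤ.* p ℤ.+ R ℤ.* p ℤ.- (e ℤ.+ R ℤ.* + ρ)  ≡⟨ calc₂ R p e (+ ρ) ⟩
    R ℤ.* p ℤ.- e ℤ.+ R ℤ.* (p ℤ.- + ρ)        ∎
    where
    calc₁ : ∀ p R X → p ℤ.* (R ℤ.+ R ℤ.- X) ≡ R ℤ.* p ℤ.+ R ℤ.* p ℤ.- p ℤ.* X
    calc₁ = ℤ-solve
    calc₂ : ∀ R p e ρ → R ℤ.* p ℤ.+ R ℤ.* p ℤ.- (e ℤ.+ R ℤ.* ρ) ≡ R ℤ.* p ℤ.- e ℤ.+ R ℤ.* (p ℤ.- ρ)
    calc₂ = ℤ-solve
  positive : + 0 ℤ.< R ℤ.* p ℤ.- e ℤ.+ R ℤ.* (p ℤ.- + ρ)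
  positive = ℤₚ.+-mono-≤-< high (subst (ℤ._< R ℤ.* (p ℤ.- + ρ)) (ℤₚ.*-zeroʳ R)
    (ℤₚ.*-monoˡ-<-pos R ρ<p))
    where
    ρ<p : + 0 ℤ.< p ℤ.- + ρ
    ρ<p = subst (ℤ._< p ℤ.- + ρ) (ℤₚ.+-inverseʳ (+ ρ)) (ℤₚ.+-monoˡ-< (ℤ.- + ρ) (ℤ.+<+ (ℕᵈ.m%n<n (toℕ s) (suc p′))))

-- Majority

module _ {n k : ℕ} (f : Fin k → Fn n) (s : Fin k → ℕ) (gs : ∀ i → HasGH (f i) (s i)) where

  private
    count : Vec Bool n → Vec Bool n → ℕ
    count x y = countTrue k (λ i → f i x y)

    cost : ℕ
    cost = 2 + 12 * sumFin k s

  surplus : Vec Bool n → Vec Bool n → ℤ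
  surplus x y = + 2 ℤ.* + count x y ℤ.- + k

  module _ (P : ℕ) .{{_ : NonZero P}} (c : ℤ) where

    private
      body : Box n (Fin P) (Fin P)
      body = sweep (↔-id _) (rotation P (+ 2 ℤ.* c)) k f s gs

      shift : Fin P ↪ Fin P
      shift = rotation P (ℤ.- (+ k ℤ.* c))

    -- Adds c D to the state: -k c at once by renaming the entrance, then 2 c for every true `f i`.
    accumulate : Box n (Fin P) (Fin P)
    accumulate = relabel shift ↪-id body

    accumulate-leads : ∀ {x y a z} → Residue a z →
                       ∃[ b ] Leads accumulate x y a b × Residue b (z ℤ.+ c ℤ.* surplus x y)
    accumulate-leads {x} {y} {a} {z} ρ =
      b , relabel-leads shift ↪-id body {i = a} {b} (sweep-leads (↔-id _) (rotation P (+ 2 ℤ.* c)) k f s gs (to shift a))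
        , subst (Residue b) (calc z (+ k) c (+ count x y))
            (iterate-residue P (+ 2 ℤ.* c) (count x y) {to shift a} (rotate-residue P (ℤ.- (+ k ℤ.* c)) {a} ρ))
      where
      b = iterate (rotate P (+ 2 ℤ.* c)) (count x y) (to shift a)
      calc : ∀ z k c m → z ℤ.+ ℤ.- (k ℤ.* c) ℤ.+ m ℤ.* (+ 2 ℤ.* c) ≡ z ℤ.+ c ℤ.* (+ 2 ℤ.* m ℤ.- k)
      calc = ℤ-solve

    accumulate-size : size accumulate ≤ P * cost
    accumulate-size = sweep-size (↔-id _) (rotation P (+ 2 ℤ.* c)) k f s gs

  module _ (K : ℕ) .{{K≢0 : NonZero K}} (m : ℕ) where

    private
      modulus : ℕ → ℕ
      modulus j = K * suc (j + m)

      instance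
        modulus≢0 : ∀ {j} → NonZero (modulus j)
        modulus≢0 {j} = ℕₚ.m*n≢0 K (suc (j + m))

      -- Modulo K (j + m + 1), adding this multiple of D turns the phase by (-1)^j C(m,j) D / (m + 1
      -- + j), one term of the alternating sum.
      turnBy : ℕ → ℤ
      turnBy j = + K ℤ.* coef m j

      first : Box n ⊤ (Fin (modulus 0))
      first = relabel (point-↪ Finₚ._≟_ (residue (modulus 0) (+ 0))) ↪-id (accumulate (modulus 0) (turnBy 0))

      next : ∀ j → Box n (Fin (modulus j)) (Fin (modulus (suc j)))
      next j = relabel (Fin-↪ (stretch K (suc (j + m))) (stretch-injective K (suc (j + m)))) ↪-id
                 (accumulate (modulus (suc j)) (turnBy (suc j)))

    scan : ∀ j → Box n ⊤ (Fin (modulus j))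
    scan zero    = first
    scan (suc j) = scan j ⨾ next j

    scan-size : ∀ j → size (scan j) ≤ suc j * (modulus j * cost)
    scan-size zero = ℕₚ.≤-trans (accumulate-size (modulus 0) (turnBy 0)) (ℕₚ.m≤m+n _ 0)
    scan-size (suc j) = begin
      size (scan j) + size (next j)
        ≤⟨ ℕₚ.+-mono-≤ (scan-size j) (accumulate-size (modulus (suc j)) (turnBy (suc j))) ⟩
      suc j * (modulus j * cost) + modulus (suc j) * cost
        ≤⟨ ℕₚ.+-monoˡ-≤ _ (ℕₚ.*-monoʳ-≤ (suc j) (ℕₚ.*-monoˡ-≤ cost (ℕₚ.*-monoʳ-≤ K (ℕₚ.n≤1+n (suc (j + m)))))) ⟩
      suc j * (modulus (suc j) * cost) + modulus (suc j) * cost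
        ≡⟨ ℕₚ.+-comm (suc j * (modulus (suc j) * cost)) _ ⟩
      suc (suc j) * (modulus (suc j) * cost) ∎
      where open ℕₚ.≤-Reasoning

    module _ (g : ℕ) (γ : ℕ → ℤ) (γ-nonneg : ∀ j → + 0 ℤ.≤ γ j)
             (γ-reciprocal : ∀ j → j ≤ m → γ (j + m) ℤ.* + suc (j + m) ≡ + suc g) (x y : Vec Bool n) where

      open Phase K m g (surplus x y) γ γ-nonneg γ-reciprocal

      scan-leads : ∀ j → j ≤ m → ∃[ a ] Leads (scan j) x y tt a × ∃[ z ] Residue a z × Approximates j z
      scan-leads zero _ =
        let b , p , ρ = accumulate-leads (modulus 0) (turnBy 0) {x} {y} (residue-correct (modulus 0) (+ 0)) in
        b , relabel-leads (point-↪ Finₚ._≟_ (residue (modulus 0) (+ 0))) ↪-id (accumulate (modulus 0) (turnBy 0)) {i = tt} {b} p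
          , + 0 ℤ.+ turnBy 0 ℤ.* surplus x y , ρ
          , subst (Approximates 0) (sym (ℤₚ.+-identityˡ _)) approximates-start
      scan-leads (suc j) j<m =
        let a , p , z , ρ , approx = scan-leads j (ℕₚ.<⇒≤ j<m)
            w , σ , r , r<p , w≡ = stretch-residue K (suc (j + m)) {a} ρ
            b , p′ , τ = accumulate-leads (modulus (suc j)) (turnBy (suc j)) {x} {y} {stretch K (suc (j + m)) a} σ
        in b , ⨾-leads (scan j) (next j) {o = b} p
                 (relabel-leads (Fin-↪ (stretch K (suc (j + m))) (stretch-injective K (suc (j + m)))) ↪-id
                    (accumulate (modulus (suc j)) (turnBy (suc j))) {i = a} {b} p′)
             , w ℤ.+ turnBy (suc j) ℤ.* surplus x y , τ
             , approximates-step {j} {z} {w} {r} j<m approx r<p w≡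

-- Growth of the denominators N and the range of D

rising>0 : ∀ a i → 0 < rising a i
rising>0 zero    i = s≤s z≤n
rising>0 (suc a) i = ℕₚ.*-mono-≤ (rising>0 a i) (s≤s z≤n)

-- Both sides times m + 1 are (m + 1)(m + 2)...(2m + 3). For N = `rising m m` / m! the ratio of
-- consecutive values is thus 2 (2m + 3) / (m + 1), which exceeds 4 and is at most 6: the first
-- bound serves `4^m*m!≤rising`, the second `near-pred`.
rising-diagonal : ∀ m → rising (suc m) (suc m) ≡ 2 * (2 * m + 3) * rising m m
rising-diagonal m = ℕₚ.*-cancelˡ-≡ _ _ (suc m) (trans (sym (rising-shift (suc m) m)) (calc (rising m m) m))
  where
  calc : ∀ r m → r * suc (suc m + m) * suc (suc (suc m) + m) ≡ suc m * (2 * (2 * m + 3) * r)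
  calc = ℕ-solve

4^m*m!≤rising : ∀ m → 4 ^ m * m ! ≤ rising m m
4^m*m!≤rising zero    = ℕₚ.≤-refl
4^m*m!≤rising (suc m) = begin
  4 * 4 ^ m * (suc m * m !)         ≡⟨ calc₁ (4 ^ m) m (m !) ⟩
  4 * suc m * (4 ^ m * m !)         ≤⟨ ℕₚ.*-mono-≤ (ℕₚ.m≤m+n (4 * suc m) 2) (4^m*m!≤rising m) ⟩
  (4 * suc m + 2) * rising m m      ≡⟨ cong (_* rising m m) (calc₂ m) ⟩
  2 * (2 * m + 3) * rising m m      ≡⟨ rising-diagonal m ⟨
  rising (suc m) (suc m)            ∎
  where
  open ℕₚ.≤-Reasoning
  calc₁ : ∀ e m f → 4 * e * (suc m * f) ≡ 4 * suc m * (e * f)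
  calc₁ = ℕ-solve
  calc₂ : ∀ m → 4 * suc m + 2 ≡ 2 * (2 * m + 3)
  calc₂ = ℕ-solve

k<2^[1+log₂k] : ∀ k → k < 2 ^ suc ⌊log₂ k ⌋
k<2^[1+log₂k] k = ℕₚ.≰⇒> λ 2^≤k → ℕₚ.<-irrefl refl
  (subst (_≤ ⌊log₂ k ⌋) (⌊log₂[2^n]⌋≡n (suc ⌊log₂ k ⌋)) (⌊log₂⌋-mono-≤ 2^≤k))

4k≤4^[2+log₂k] : ∀ k → 4 * k ≤ 4 ^ (2 + ⌊log₂ k ⌋)
4k≤4^[2+log₂k] k = ℕₚ.*-monoʳ-≤ 4 (begin
  k                        ≤⟨ ℕₚ.<⇒≤ (k<2^[1+log₂k] k) ⟩
  2 ^ suc ⌊log₂ k ⌋        ≤⟨ ℕₚ.^-monoˡ-≤ (suc ⌊log₂ k ⌋) (s≤s (s≤s z≤n)) ⟩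
  4 ^ suc ⌊log₂ k ⌋        ∎)
  where open ℕₚ.≤-Reasoning

countTrue≤ : ∀ k z → countTrue k z ≤ k
countTrue≤ zero    z = z≤n
countTrue≤ (suc k) z rewrite countTrue-suc k z with z zero
... | true  = s≤s (countTrue≤ k (z ∘ suc))
... | false = ℕₚ.m≤n⇒m≤1+n (countTrue≤ k (z ∘ suc))

-- The common multiple (2m + 1)! makes all quotients G / (j + 1) required by `Phase` integral. It
-- occurs only in the proof, not in the network, so its size is harmless.
module Reciprocals (m : ℕ) where

  N! : ℕ
  N! = suc (m + m) !

  γ : ℕ → ℤ
  γ j = + (N! / suc j)

  γ-nonneg : ∀ j → + 0 ℤ.≤ γ j
  γ-nonneg j = 0≤pos (N! / suc j)

  g : ℕ
  g = ℕ.pred N!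

  γ-reciprocal : ∀ j → j ≤ m → γ (j + m) ℤ.* + suc (j + m) ≡ + suc g
  γ-reciprocal j j≤m = begin
    + (N! / suc (j + m)) ℤ.* + suc (j + m)   ≡⟨ ℤₚ.pos-* (N! / suc (j + m)) (suc (j + m)) ⟨
    + (N! / suc (j + m) * suc (j + m))       ≡⟨ cong +_ (ℕᵈ.m/n*n≡m (ℕ∣.∣-trans (ℕ∣.m∣m*n ((j + m) !)) (ℕ∣.m≤n⇒m!∣n! (s≤s (ℕₚ.+-monoˡ-≤ m j≤m))))) ⟩
    + N!                                     ≡⟨ cong +_ (ℕₚ.suc-pred N! {{ℕₚ._!≢0 (suc (m + m))}}) ⟨
    + suc g                                  ∎
    where open ≡-Reasoning

-- |D| ≤ N / 4 with N = `rising m m` / m!, cleared of denominators.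
Near : ℕ → ℤ → Set
Near m D = + 0 ℤ.≤ + rising m m ℤ.- + 4 ℤ.* (D ℤ.* + (m !)) × + 0 ℤ.≤ + rising m m ℤ.+ + 4 ℤ.* (D ℤ.* + (m !))

-- N for m is at least a sixth of N for m + 1, so a bound by a 24th of the latter gives a quarter of
-- the former. The term `slack` comes from 6 (m + 1) - 2 (2m + 3) = 2m.
near-pred : ∀ m D → Judged (+ rising (suc m) (suc m)) (D ℤ.* + (suc m !)) (inj₁ tt) → Near m D
near-pred m D (upper , lower) =
    0≤-cancel 5 (0≤-cancel m (subst (+ 0 ℤ.≤_) upper≡ (0≤+ upper slack)))
  , 0≤-cancel 5 (0≤-cancel m (subst (+ 0 ℤ.≤_) lower≡ (0≤+ lower slack)))
  where
  open ≡-Reasoning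
  R = + rising m m
  R′ = + rising (suc m) (suc m)
  F = + (m !)
  slack : + 0 ℤ.≤ + 2 ℤ.* + m ℤ.* R
  slack = 0≤* (0≤* (0≤pos 2) (0≤pos m)) (0≤pos (rising m m))
  R′≡ : R′ ≡ + 2 ℤ.* (+ 2 ℤ.* + m ℤ.+ + 3) ℤ.* R
  R′≡ = begin
    R′                                                ≡⟨ cong +_ (rising-diagonal m) ⟩
    + (2 * (2 * m + 3) * rising m m)                  ≡⟨ ℤₚ.pos-* (2 * (2 * m + 3)) (rising m m) ⟩
    + (2 * (2 * m + 3)) ℤ.* R                         ≡⟨ cong (ℤ._* R) (ℤₚ.pos-* 2 (2 * m + 3)) ⟩
    + 2 ℤ.* (+ (2 * m) ℤ.+ + 3) ℤ.* R                 ≡⟨ cong (λ a → + 2 ℤ.* (a ℤ.+ + 3) ℤ.* R) (ℤₚ.pos-* 2 m) ⟩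
    + 2 ℤ.* (+ 2 ℤ.* + m ℤ.+ + 3) ℤ.* R               ∎
  upper≡ : R′ ℤ.- + 24 ℤ.* (D ℤ.* + (suc m !)) ℤ.+ + 2 ℤ.* + m ℤ.* R
         ≡ + suc m ℤ.* (+ 6 ℤ.* (R ℤ.- + 4 ℤ.* (D ℤ.* F)))
  upper≡ = trans (cong₂ (λ a b → a ℤ.- + 24 ℤ.* (D ℤ.* b) ℤ.+ + 2 ℤ.* + m ℤ.* R) R′≡ (ℤₚ.pos-* (suc m) (m !))) (calc (+ m) R D F)
    where
    calc : ∀ m R D F → + 2 ℤ.* (+ 2 ℤ.* m ℤ.+ + 3) ℤ.* R ℤ.- + 24 ℤ.* (D ℤ.* ((+ 1 ℤ.+ m) ℤ.* F)) ℤ.+ + 2 ℤ.* m ℤ.* R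
                     ≡ (+ 1 ℤ.+ m) ℤ.* (+ 6 ℤ.* (R ℤ.- + 4 ℤ.* (D ℤ.* F)))
    calc = ℤ-solve
  lower≡ : R′ ℤ.+ + 24 ℤ.* (D ℤ.* + (suc m !)) ℤ.+ + 2 ℤ.* + m ℤ.* R
         ≡ + suc m ℤ.* (+ 6 ℤ.* (R ℤ.+ + 4 ℤ.* (D ℤ.* F)))
  lower≡ = trans (cong₂ (λ a b → a ℤ.+ + 24 ℤ.* (D ℤ.* b) ℤ.+ + 2 ℤ.* + m ℤ.* R) R′≡ (ℤₚ.pos-* (suc m) (m !))) (calc (+ m) R D F)
    where
    calc : ∀ m R D F → + 2 ℤ.* (+ 2 ℤ.* m ℤ.+ + 3) ℤ.* R ℤ.+ + 24 ℤ.* (D ℤ.* ((+ 1 ℤ.+ m) ℤ.* F)) ℤ.+ + 2 ℤ.* m ℤ.* R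
                     ≡ (+ 1 ℤ.+ m) ℤ.* (+ 6 ℤ.* (R ℤ.+ + 4 ℤ.* (D ℤ.* F)))
    calc = ℤ-solve

-- For m = 0 the denominator N is 1, and |D| ≤ 1 / 4 forces D = 0, a tie, which counts as a
-- majority.
near-0 : ∀ D → Near 0 D → + 0 ℤ.≤ D
near-0 (+ _)    _ = ℤ.+≤+ z≤n
near-0 -[1+ n ] (_ , lower) = ⊥-elim (absurd (subst (+ 0 ℤ.≤_) (calc (+ n)) (0≤+ lower (0≤* (0≤pos 4) (0≤pos n)))))
  where
  absurd : ¬ + 0 ℤ.≤ ℤ.- + 3
  absurd ()
  calc : ∀ n → + 1 ℤ.+ + 4 ℤ.* ((ℤ.- (+ 1 ℤ.+ n)) ℤ.* + 1) ℤ.+ + 4 ℤ.* n ≡ ℤ.- + 3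
  calc = ℤ-solve

-- |D| ≤ k ≤ 4^m / 4 ≤ N / 4, where |D| ≤ k comes from 0 ≤ c ≤ k.
near-start : ∀ k c m → c ≤ k → 4 * k ≤ 4 ^ m → Near m (+ 2 ℤ.* + c ℤ.- + k)
near-start k c m c≤k 4k≤4^m =
    subst (+ 0 ℤ.≤_) (calc₁ R F (+ k) (+ c)) (0≤+ room (0≤* (0≤* (0≤pos 8) (ℤₚ.i≤j⇒0≤j-i (ℤ.+≤+ c≤k))) (0≤pos (m !))))
  , subst (+ 0 ℤ.≤_) (calc₂ R F (+ k) (+ c)) (0≤+ room (0≤* (0≤* (0≤pos 8) (0≤pos c)) (0≤pos (m !))))
  where
  R = + rising m m
  F = + (m !)
  room : + 0 ℤ.≤ R ℤ.- + 4 ℤ.* + k ℤ.* F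
  room = ℤₚ.i≤j⇒0≤j-i (subst (ℤ._≤ R) (trans (ℤₚ.pos-* (4 * k) (m !)) (cong (ℤ._* F) (ℤₚ.pos-* 4 k)))
    (ℤ.+≤+ (ℕₚ.≤-trans (ℕₚ.*-monoˡ-≤ (m !) 4k≤4^m) (4^m*m!≤rising m))))
  calc₁ : ∀ R F k c → R ℤ.- + 4 ℤ.* k ℤ.* F ℤ.+ + 8 ℤ.* (k ℤ.- c) ℤ.* F ≡ R ℤ.- + 4 ℤ.* ((+ 2 ℤ.* c ℤ.- k) ℤ.* F)
  calc₁ = ℤ-solve
  calc₂ : ∀ R F k c → R ℤ.- + 4 ℤ.* k ℤ.* F ℤ.+ + 8 ℤ.* c ℤ.* F ≡ R ℤ.+ + 4 ℤ.* ((+ 2 ℤ.* c ℤ.- k) ℤ.* F)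
  calc₂ = ℤ-solve

judge-nonzero : ∀ p′ R → 0 < R → ∀ (D F z : ℤ) (s : Fin (48 * suc p′)) → Residue s z →
  let p = + suc p′; e = + 48 ℤ.* p ℤ.* D ℤ.* F ℤ.- z ℤ.* + R in
  + 0 ℤ.≤ e → + 0 ℤ.≤ + R ℤ.* p ℤ.- e →
  + 0 ℤ.≤ + R ℤ.- + 4 ℤ.* (D ℤ.* F) → + 0 ℤ.≤ + R ℤ.+ + 4 ℤ.* (D ℤ.* F) →
  Judged (+ R) (D ℤ.* F) (judge (toℕ s / suc p′))
judge-nonzero p′ (suc r) _ = judge-state p′ r

-- Rounds of the majority program and their iteration

module _ {n k : ℕ} (f : Fin k → Fn n) (s : Fin k → ℕ) (gs : ∀ i → HasGH (f i) (s i)) where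

  private
    outcomes : Fin 3 ↔ (⊤ ⊎ Bool)
    outcomes = (Finₚ.1↔⊤ ⊎-↔ Finₚ.2↔Bool) ↔-∘ Finₚ.+↔⊎

    _≟ₒ_ : DecidableEquality (⊤ ⊎ Bool)
    _≟ₒ_ = ⊎-≡-dec ⊤ₚ._≟_ Boolₚ._≟_

    verdictOf : ∀ m → Fin (48 * suc (m + m)) → ⊤ ⊎ Bool
    verdictOf m a = judge (toℕ a / suc (m + m))

    cost : ℕ
    cost = 2 + 12 * sumFin k s

  -- Merging the 48 (2m + 1) states into three exits forgets the phase, so that the next round
  -- starts from a single entrance. With a reversed copy per outcome the scan is paid for four
  -- times.
  stage : ℕ → Box n ⊤ (⊤ ⊎ Bool)
  stage m = classify outcomes _≟ₒ_ (verdictOf m) (scan f s gs 48 m m)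

  stage-size : ∀ m → size (stage m) ≤ 4 * (suc m * (48 * suc (m + m) * cost))
  stage-size m = ℕₚ.*-monoʳ-≤ 4 (scan-size f s gs 48 m m)

  stage-leads : ∀ m x y → Near m (surplus f s gs x y) →
    ∃[ o ] Leads (stage m) x y tt o × Judged (+ rising m m) (surplus f s gs x y ℤ.* + (m !)) o
  stage-leads m x y (upper , lower) =
    let a , p , z , ρ , approx = scan-leads f s gs 48 m g γ γ-nonneg γ-reciprocal x y m ℕₚ.≤-refl
        low , high = approximation {z} approx
    in verdictOf m a , classify-leads outcomes _≟ₒ_ (verdictOf m) (scan f s gs 48 m m) {o = a} p
     , judge-nonzero (m + m) (rising m m) (rising>0 m m) (surplus f s gs x y) (+ (m !)) z a ρ low high upper lower
    where
    open Reciprocals m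
    open Phase 48 m g (surplus f s gs x y) γ γ-nonneg γ-reciprocal using (approximation)

maj-nonneg : ∀ k z → + 0 ℤ.≤ + 2 ℤ.* + countTrue k z ℤ.- + k → true ≡ maj k z
maj-nonneg k z 0≤D = sym (Equivalence.to Boolₚ.T-≡ (ℕₚ.≤⇒≤ᵇ
  (ℤₚ.drop‿+≤+ (subst (+ k ℤ.≤_) (sym (ℤₚ.pos-* 2 (countTrue k z))) (ℤₚ.0≤i-j⇒j≤i 0≤D)))))

maj-negative : ∀ k z → + 2 ℤ.* + countTrue k z ℤ.- + k ℤ.< + 0 → false ≡ maj k z
maj-negative k z D<0 = sym (Boolₚ.¬-not λ maj≡true → ℤₚ.<⇒≱ D<0 (ℤₚ.i≤j⇒0≤j-i
  (subst (+ k ℤ.≤_) (ℤₚ.pos-* 2 (countTrue k z)) (ℤ.+≤+ (ℕₚ.≤ᵇ⇒≤ k _ (Equivalence.from Boolₚ.T-≡ maj≡true))))))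

module _ {n k : ℕ} (f : Fin k → Fn n) (s : Fin k → ℕ) (gs : ∀ i → HasGH (f i) (s i)) where

  private
    D : Vec Bool n → Vec Bool n → ℤ
    D = surplus f s gs

    Σs cost : ℕ
    Σs = sumFin k s
    cost = 2 + 12 * Σs

    nonneg : ∀ x y → + 0 ℤ.≤ D x y → true ≡ MAJf k f x y
    nonneg x y = maj-nonneg k (λ i → f i x y)

    negative : ∀ x y → D x y ℤ.< + 0 → false ≡ MAJf k f x y
    negative x y = maj-negative k (λ i → f i x y)

    descent-bound : ℕ → ℕ → ℕ
    descent-bound M m = m * (4 * (suc M * (48 * suc (M + M) * cost)) + 4) + 2

  -- `M` bounds all m that occur, so that every stage is charged the same amount. An undecided stage
  -- establishes the promise for the next smaller m, and m = 0 leaves only the tie.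
  descent : ∀ {M} m → m ≤ M → Decider (λ x y → Near m (D x y)) (MAJf k f) (descent-bound M m)
  descent zero _ = record
    { Exit = ⊤ ; verdict = λ _ → true ; box = wire Finₚ.1↔⊤ ; small = ℕₚ.≤-refl
    ; correct = λ x y near → tt , wire-leads Finₚ.1↔⊤ tt , nonneg x y (near-0 (D x y) near) }
  descent {M} (suc m) m<M = decider-cong bound (λ _ _ → refl)
    (continue-with Finₚ.2↔Bool id (stage f s gs (suc m)) (descent m (ℕₚ.<⇒≤ m<M)) next)
    where
    sound : ∀ x y o → Judged (+ rising (suc m) (suc m)) (D x y ℤ.* + (suc m !)) o →
            Sound id (λ x y → Near m (D x y)) (MAJf k f) (MAJf k f) x y o
    sound x y (inj₁ tt)    near = near-pred m (D x y) near , refl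
    sound x y (inj₂ true)  0<DF = nonneg x y (ℤₚ.<⇒≤ (ℤₚ.*-cancelʳ-<-nonNeg (+ (suc m !)) 0<DF))
    sound x y (inj₂ false) DF<0 = negative x y (ℤₚ.*-cancelʳ-<-nonNeg (+ (suc m !)) DF<0)

    next : ∀ x y → Near (suc m) (D x y) → ∃[ o ] Leads (stage f s gs (suc m)) x y tt o ×
           Sound id (λ x y → Near m (D x y)) (MAJf k f) (MAJf k f) x y o
    next x y near = let o , p , judged = stage-leads f s gs (suc m) x y near in o , p , sound x y o judged

    bound : size (stage f s gs (suc m)) + (descent-bound M m + (2 + 2)) ≤ descent-bound M (suc m)
    bound = begin
      size (stage f s gs (suc m)) + (m * (A + 4) + 2 + 4)
        ≤⟨ ℕₚ.+-monoˡ-≤ _ (stage-size f s gs (suc m)) ⟩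
      4 * (suc (suc m) * (48 * suc (suc m + suc m) * cost)) + (m * (A + 4) + 2 + 4)
        ≤⟨ ℕₚ.+-monoˡ-≤ _ (ℕₚ.*-monoʳ-≤ 4 (ℕₚ.*-mono-≤ (s≤s m<M)
             (ℕₚ.*-monoˡ-≤ cost (ℕₚ.*-monoʳ-≤ 48 (s≤s (ℕₚ.+-mono-≤ m<M m<M)))))) ⟩
      A + (m * (A + 4) + 2 + 4)
        ≡⟨ calc A m ⟩
      suc m * (A + 4) + 2 ∎
      where
      open ℕₚ.≤-Reasoning
      A = 4 * (suc M * (48 * suc (M + M) * cost))
      calc : ∀ A m → A + (m * (A + 4) + 2 + 4) ≡ suc m * (A + 4) + 2
      calc = ℕ-solve

  majority : Decider always (MAJf k f) (descent-bound (2 + ⌊log₂ k ⌋) (2 + ⌊log₂ k ⌋))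
  majority = record
    { Exit = Exit d ; verdict = verdict d ; box = box d ; small = small d
    ; correct = λ x y _ → correct d x y
        (near-start k (countTrue k (λ i → f i x y)) (2 + ⌊log₂ k ⌋) (countTrue≤ k _) (4k≤4^[2+log₂k] k)) }
    where
    d = descent (2 + ⌊log₂ k ⌋) ℕₚ.≤-refl

  private
    -- The three factors 1 + L are due to the number of rounds, the number of moduli in a round and
    -- the size of the moduli. The additive constants are absorbed by `1 ≤ Σ`, and 241950 = 3 (2 (4
    -- · 3 · 48 · 5 · 14 + 4) + 2).
    polylog : ∀ L Σ → 1 ≤ Σ → let M = 2 + L in
      3 * (M * (4 * (suc M * (48 * suc (M + M) * (2 + 12 * Σ))) + 4) + 2) ≤ 241950 * Σ * (1 + L) ^ 3
    polylog L Σ 1≤Σ = begin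
      3 * (M * (4 * (suc M * (48 * suc (M + M) * (2 + 12 * Σ))) + 4) + 2)
        ≤⟨ ℕₚ.*-monoʳ-≤ 3 (ℕₚ.+-mono-≤ (ℕₚ.*-mono-≤ M≤ (ℕₚ.+-mono-≤ (ℕₚ.*-monoʳ-≤ 4 (ℕₚ.*-mono-≤ sucM≤
             (ℕₚ.*-mono-≤ (ℕₚ.*-monoʳ-≤ 48 2M+1≤) cost≤))) 4≤)) 2≤) ⟩
      3 * (2 * suc L * (4 * (3 * suc L * (48 * (5 * suc L) * (14 * Σ))) + 4 * (suc L * suc L * Σ)) + 2 * (suc L * (suc L * suc L * Σ)))
        ≡⟨ calc (suc L) Σ ⟩
      241950 * Σ * (1 + L) ^ 3 ∎
      where
      open ℕₚ.≤-Reasoning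
      M = 2 + L
      M≤ : 2 + L ≤ 2 * suc L
      M≤ = subst (2 + L ≤_) (lemma L) (ℕₚ.m≤m+n _ L)
        where
        lemma : ∀ L → 2 + L + L ≡ 2 * suc L
        lemma = ℕ-solve
      sucM≤ : 3 + L ≤ 3 * suc L
      sucM≤ = subst (3 + L ≤_) (lemma L) (ℕₚ.m≤m+n _ (2 * L))
        where
        lemma : ∀ L → 3 + L + 2 * L ≡ 3 * suc L
        lemma = ℕ-solve
      2M+1≤ : suc (2 + L + (2 + L)) ≤ 5 * suc L
      2M+1≤ = subst (suc (2 + L + (2 + L)) ≤_) (lemma L) (ℕₚ.m≤m+n _ (3 * L))
        where
        lemma : ∀ L → suc (2 + L + (2 + L)) + 3 * L ≡ 5 * suc L
        lemma = ℕ-solve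
      cost≤ : 2 + 12 * Σ ≤ 14 * Σ
      cost≤ = subst (2 + 12 * Σ ≤_) (lemma Σ) (ℕₚ.+-monoˡ-≤ (12 * Σ) (ℕₚ.*-monoʳ-≤ 2 1≤Σ))
        where
        lemma : ∀ r → 2 * r + 12 * r ≡ 14 * r
        lemma = ℕ-solve
      1≤λ²Σ : 1 ≤ suc L * suc L * Σ
      1≤λ²Σ = ℕₚ.*-mono-≤ {1} {suc L * suc L} {1} {Σ} (ℕₚ.*-mono-≤ {1} {suc L} {1} {suc L} (s≤s z≤n) (s≤s z≤n)) 1≤Σ
      4≤ : 4 ≤ 4 * (suc L * suc L * Σ)
      4≤ = ℕₚ.*-monoʳ-≤ 4 1≤λ²Σ
      2≤ : 2 ≤ 2 * (suc L * (suc L * suc L * Σ))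
      2≤ = ℕₚ.*-monoʳ-≤ 2 (ℕₚ.*-mono-≤ {1} {suc L} {1} {suc L * suc L * Σ} (s≤s z≤n) 1≤λ²Σ)
      calc : ∀ l r → 3 * (2 * l * (4 * (3 * l * (48 * (5 * l) * (14 * r))) + 4 * (l * l * r)) + 2 * (l * (l * l * r)))
                   ≡ 241950 * r * (l * (l * (l * 1)))
      calc = ℕ-solve

  GH-MAJ : 1 ≤ k → GH≤ (MAJf k f) (241950 * sumFin k s * (1 + ⌊log₂ k ⌋) ^ 3)
  GH-MAJ 1≤k = nonempty-GH≤ 1≤k f s gs (λ x y z≡ → maj-false z≡)
    λ 1≤Σ → let t , t≤ , γ = decider⇒GH≤ majority in t , ℕₚ.≤-trans t≤ (polylog ⌊log₂ k ⌋ Σs 1≤Σ) , γ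
    where
    maj-false : ∀ {z} → (∀ i → z i ≡ false) → maj k z ≡ false
    maj-false {z} z≡ rewrite countTrue-false k z z≡ = zero< 1≤k
      where
      zero< : ∀ {k} → 1 ≤ k → (k ℕ.≤ᵇ 0) ≡ false
      zero< (s≤s _) = refl

GH≤-mono : ∀ {n} {h : Fn n} {a b} → a ≤ b → GH≤ h a → GH≤ h b
GH≤-mono a≤b (t , t≤a , γ) = t , ℕₚ.≤-trans t≤a a≤b , γ

theorem3 : ∃[ C ] (∀ (n k : ℕ) → 1 ≤ k → (f : Fin k → Fn n) → (s : Fin k → ℕ)
    → (∀ i → HasGH (f i) (s i))
    → GH≤ (ORf k f) (C * sumFin k s)
    × GH≤ (ANDf k f) (C * sumFin k s)
    × GH≤ (XORf k f) (C * sumFin k s)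
    × GH≤ (MAJf k f) (C * sumFin k s * (1 + ⌊log₂ k ⌋) ^ 3))
theorem3 = 241950 , λ n k 1≤k f s gs →
    GH≤-mono (ℕₚ.*-monoˡ-≤ (sumFin k s) (ℕₚ.m≤m+n 30 241920)) (GH-OR 1≤k f s gs)
  , GH≤-mono (ℕₚ.*-monoˡ-≤ (sumFin k s) (ℕₚ.m≤m+n 30 241920)) (GH-AND 1≤k f s gs)
  , GH≤-mono (ℕₚ.*-monoˡ-≤ (sumFin k s) (ℕₚ.m≤m+n 84 241866)) (GH-XOR 1≤k f s gs)
  , GH-MAJ f s gs 1≤k
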